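{- Let $q$ be a prime power, $\mathbb{A}=\mathbb{F}_q[t]$, and let $f,g\in\mathbb{A}$ be non-constant polynomials. Then $(f,g)$ is a Chen pair if and only if $\deg f<\gamma(g)$.
   Context: $\mathbb{F}_q$ is the finite field with $q$ elements and $\mathbb{A}=\mathbb{F}_q[t]$. For a non-constant $f\in\mathbb{A}$, $\mathbb{A}_f=\mathbb{A}/f\mathbb{A}$ is the residue class ring modulo $f$, and $\mathcal{A}_f=\{h\in\mathbb{A}:\deg h<\deg f\}\cup\{0\}$, a complete set of representatives of the residue classes modulo $f$; for $h\in\mathcal{A}_f$, $\bar h$ denotes the residue class of $h$ modulo $f$. A function $\sigma:\mathbb{A}_f\to\mathbb{A}_g$ is a polynomial function if there is $F\in\mathbb{A}[x]$ such that $\sigma(\bar h)=F(h)\bmod g$ for all $h\in\mathcal{A}_f$. A function $\sigma:\mathbb{A}_f\to\mathbb{A}_g$ is called congruence preserving if for all $h_1,h_2\in\mathcal{A}_f$ and every $h\in\mathbb{A}$ dividing $g$, $h_1\equiv h_2\pmod h$ implies $\sigma(\bar h_1)\equiv\sigma(\bar h_2)\pmod h$ (here $h_1,h_2$ are regarded as elements of $\mathbb{A}$, and reduction modulo $h$ of elements of $\mathbb{A}_g$ is well defined since $h\mid g$). $(f,g)$ is a Chen pair if every congruence preserving function from $\mathbb{A}_f$ to $\mathbb{A}_g$ is a polynomial function. The function $\gamma:\mathbb{A}\setminus\mathbb{F}_q\to\mathbb{N}\cup\{\infty\}$ is defined as follows. For $P$ irreducible and $e\ge1$: if $q=2$, then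 $\gamma(P^e)=\infty$ if $e=1$, $\gamma(P^e)=\infty$ if $e=2$ and $\deg P=1$, and $\gamma(P^e)=\deg P+2$ otherwise; if $q>2$, then $\gamma(P^e)=\infty$ if $e=1$ and $\gamma(P^e)=\deg P+1$ otherwise. For any other non-constant polynomial $h$ with prime factorization $h=\beta Q_1^{k_1}\cdots Q_s^{k_s}$, $\beta\in\mathbb{F}_q^*$ ($Q_i$ pairwise distinct monic irreducible, $k_i\ge1$), $\gamma(h)=\min\{\gamma(Q_1^{k_1}),\dots,\gamma(Q_s^{k_s})\}$. -}

module Defs where

open import Algebra.Bundles using (CommutativeRing)
open import Algebra.Definitions using (Invertible)
open import Algebra.Definitions.RawMagma using (_,_)
import Algebra.Properties.AbelianGroup as AbelianGroupProperties
import Algebra.Properties.CommutativeSemigroup as CommutativeSemigroupProperties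
import Algebra.Properties.Ring as RingProperties
import Algebra.Properties.Semiring.Divisibility as Divisibility
import Algebra.Properties.Semiring.Exp as Exp
import Algebra.Properties.Semiring.Primality as Primality
open import Data.Fin.Base using (Fin)
import Data.Fin.Properties as Fin
open import Data.List.Base using (List; []; _∷_; map; foldr; allFin; cartesianProductWith)
open import Data.List.Membership.Propositional using (_∈_; lose)
open import Data.List.Membership.Propositional.Properties
  using (∈-map⁺; ∈-allFin; ∈-cartesianProductWith⁺)
open import Data.List.Relation.Unary.All using (All; []; _∷_)
open import Data.List.Relation.Unary.AllPairs using (AllPairs; []; _∷_)
open import Data.List.Relation.Unary.Any using (here; any?; satisfied)
open import Data.Nat.Base as ℕ using (ℕ; zero; suc; z≤n; s≤s; s≤s⁻¹)
import Data.Nat.Primality as ℕ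
import Data.Nat.Properties as ℕ
open import Data.Product.Base using (Σ-syntax; ∃-syntax; _×_; _,_; proj₁; proj₂)
open import Data.Sum.Base using (_⊎_; inj₁; inj₂)
open import Function.Base using (_∘_)
open import Function.Bundles using (Func; Inverse)
open import Level using (_⊔_) renaming (suc to lsuc)
open import Relation.Binary.Bundles using (Setoid)
open import Relation.Binary.Construct.Add.Supremum.Strict ℕ._<_ public using (_<⁺_)
open import Relation.Binary.Definitions using (tri<; tri≈; tri>)
open import Relation.Binary.PropositionalEquality as ≡ using (_≡_)
import Relation.Binary.Reasoning.Setoid as SetoidReasoning
open import Relation.Binary.Structures using (IsEquivalence)
open import Relation.Nullary.Construct.Add.Supremum public using (_⁺; [_]; ⊤⁺)
open import Relation.Nullary.Decidable using (Dec; yes; no; map′; _×-dec_)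
open import Relation.Nullary.Negation using (¬_; contradiction)

-- A polynomial is the list of its coefficients, constant term first.
-- Trailing zeros are allowed, so equality compares all coefficients.

module Polynomial {c ℓ} (R : CommutativeRing c ℓ) where

  private module R = CommutativeRing R

  open RingProperties R.ring using (-0#≈0#)

  Poly : Set c
  Poly = List R.Carrier

  coeff : Poly → ℕ → R.Carrier
  coeff []      _       = R.0#
  coeff (a ∷ p) zero    = a
  coeff (a ∷ p) (suc n) = coeff p n

  infix  4 _≈_
  infix  8 -_
  infixl 7 _·_ _*_
  infixl 6 _+_

  -- A record rather than a function type, so that both polynomials can
  -- be inferred from an equation between them.

  record _≈_ (p q : Poly) : Set ℓ where
    constructor mk≈
    field at : ∀ n → coeff p n R.≈ coeff q n

  open _≈_ public

  const : R.Carrier → Poly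
  const a = a ∷ []

  0# 1# : Poly
  0# = []
  1# = const R.1#

  _+_ : Poly → Poly → Poly
  []      + q       = q
  (a ∷ p) + []      = a ∷ p
  (a ∷ p) + (b ∷ q) = a R.+ b ∷ p + q

  -_ : Poly → Poly
  -_ = map (λ a → R.- a)

  _·_ : R.Carrier → Poly → Poly
  a · p = map (a R.*_) p

  _*_ : Poly → Poly → Poly
  []      * q = []
  (a ∷ p) * q = a · q + (R.0# ∷ p * q)

  eval : Poly → R.Carrier → R.Carrier
  eval []      x = R.0#
  eval (a ∷ p) x = a R.+ x R.* eval p x

  coeff-+ : ∀ p q n → coeff (p + q) n R.≈ coeff p n R.+ coeff q n
  coeff-+ []      q       n       = R.sym (R.+-identityˡ _)
  coeff-+ (a ∷ p) []      n       = R.sym (R.+-identityʳ _)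
  coeff-+ (a ∷ p) (b ∷ q) zero    = R.refl
  coeff-+ (a ∷ p) (b ∷ q) (suc n) = coeff-+ p q n

  coeff-neg : ∀ p n → coeff (- p) n R.≈ R.- coeff p n
  coeff-neg []      n       = R.sym -0#≈0#
  coeff-neg (a ∷ p) zero    = R.refl
  coeff-neg (a ∷ p) (suc n) = coeff-neg p n

  coeff-· : ∀ a p n → coeff (a · p) n R.≈ a R.* coeff p n
  coeff-· a []      n       = R.sym (R.zeroʳ a)
  coeff-· a (b ∷ p) zero    = R.refl
  coeff-· a (b ∷ p) (suc n) = coeff-· a p n

  ≈-isEquivalence : IsEquivalence _≈_
  ≈-isEquivalence = record
    { refl  = mk≈ λ n → R.refl
    ; sym   = λ e → mk≈ λ n → R.sym (at e n)
    ; trans = λ e f → mk≈ λ n → R.trans (at e n) (at f n)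
    }

  ≈-setoid : Setoid c ℓ
  ≈-setoid = record { isEquivalence = ≈-isEquivalence }

  open IsEquivalence ≈-isEquivalence
    using () renaming (refl to ≈-refl; sym to ≈-sym; trans to ≈-trans)

  ∷-cong : ∀ {a b p q} → a R.≈ b → p ≈ q → a ∷ p ≈ b ∷ q
  at (∷-cong a≈b p≈q) zero    = a≈b
  at (∷-cong a≈b p≈q) (suc n) = at p≈q n

  ∷≈0 : ∀ {a p} → a R.≈ R.0# → p ≈ 0# → a ∷ p ≈ 0#
  at (∷≈0 a≈0 p≈0) zero    = a≈0
  at (∷≈0 a≈0 p≈0) (suc n) = at p≈0 n

  tail≈0 : ∀ {a p} → a ∷ p ≈ 0# → p ≈ 0#
  at (tail≈0 e) n = at e (suc n)

  +-cong : ∀ {p p′ q q′} → p ≈ p′ → q ≈ q′ → p + q ≈ p′ + q′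
  at (+-cong {p} {p′} {q} {q′} e f) n = R.trans (coeff-+ p q n)
    (R.trans (R.+-cong (at e n) (at f n)) (R.sym (coeff-+ p′ q′ n)))

  +-assoc : ∀ p q r → (p + q) + r ≈ p + (q + r)
  at (+-assoc p q r) n = begin
    coeff ((p + q) + r) n                     ≈⟨ coeff-+ (p + q) r n ⟩
    coeff (p + q) n R.+ coeff r n             ≈⟨ R.+-congʳ (coeff-+ p q n) ⟩
    (coeff p n R.+ coeff q n) R.+ coeff r n   ≈⟨ R.+-assoc _ _ _ ⟩
    coeff p n R.+ (coeff q n R.+ coeff r n)   ≈⟨ R.+-congˡ (coeff-+ q r n) ⟨
    coeff p n R.+ coeff (q + r) n             ≈⟨ coeff-+ p (q + r) n ⟨
    coeff (p + (q + r)) n                     ∎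
    where open SetoidReasoning R.setoid

  +-comm : ∀ p q → p + q ≈ q + p
  at (+-comm p q) n = R.trans (coeff-+ p q n)
    (R.trans (R.+-comm _ _) (R.sym (coeff-+ q p n)))

  +-identityˡ : ∀ p → 0# + p ≈ p
  +-identityˡ p = ≈-refl

  +-identityʳ : ∀ p → p + 0# ≈ p
  +-identityʳ p = +-comm p 0#

  -‿cong : ∀ {p q} → p ≈ q → - p ≈ - q
  at (-‿cong {p} {q} e) n = R.trans (coeff-neg p n)
    (R.trans (R.-‿cong (at e n)) (R.sym (coeff-neg q n)))

  -‿inverseˡ : ∀ p → - p + p ≈ 0#
  at (-‿inverseˡ p) n = R.trans (coeff-+ (- p) p n)
    (R.trans (R.+-congʳ (coeff-neg p n)) (R.-‿inverseˡ _))

  -‿inverseʳ : ∀ p → p + - p ≈ 0#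
  -‿inverseʳ p = ≈-trans (+-comm p (- p)) (-‿inverseˡ p)

  +-interchange : ∀ p q r s → (p + q) + (r + s) ≈ (p + r) + (q + s)
  +-interchange = CommutativeSemigroupProperties.interchange record
    { isCommutativeSemigroup = record
      { isSemigroup = record
        { isMagma = record { isEquivalence = ≈-isEquivalence ; ∙-cong = +-cong }
        ; assoc   = +-assoc
        }
      ; comm = +-comm
      }
    }

  0∷-+ : ∀ p q → R.0# ∷ p + q ≈ (R.0# ∷ p) + (R.0# ∷ q)
  0∷-+ p q = ∷-cong (R.sym (R.+-identityˡ _)) ≈-refl

  ·-cong : ∀ {a b p q} → a R.≈ b → p ≈ q → a · p ≈ b · q
  at (·-cong {a} {b} {p} {q} a≈b e) n = R.trans (coeff-· a p n)
    (R.trans (R.*-cong a≈b (at e n)) (R.sym (coeff-· b q n)))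

  ·-zeroˡ : ∀ p → R.0# · p ≈ 0#
  at (·-zeroˡ p) n = R.trans (coeff-· R.0# p n) (R.zeroˡ _)

  ·-identityˡ : ∀ p → R.1# · p ≈ p
  at (·-identityˡ p) n = R.trans (coeff-· R.1# p n) (R.*-identityˡ _)

  ·-distribˡ : ∀ a p q → a · (p + q) ≈ a · p + a · q
  at (·-distribˡ a p q) n = begin
    coeff (a · (p + q)) n                  ≈⟨ coeff-· a (p + q) n ⟩
    a R.* coeff (p + q) n                  ≈⟨ R.*-congˡ (coeff-+ p q n) ⟩
    a R.* (coeff p n R.+ coeff q n)        ≈⟨ R.distribˡ _ _ _ ⟩
    a R.* coeff p n R.+ a R.* coeff q n    ≈⟨ R.+-cong (coeff-· a p n) (coeff-· a q n) ⟨
    coeff (a · p) n R.+ coeff (a · q) n    ≈⟨ coeff-+ (a · p) (a · q) n ⟨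
    coeff (a · p + a · q) n                ∎
    where open SetoidReasoning R.setoid

  ·-distribʳ : ∀ a b p → (a R.+ b) · p ≈ a · p + b · p
  at (·-distribʳ a b p) n = begin
    coeff ((a R.+ b) · p) n                ≈⟨ coeff-· _ p n ⟩
    (a R.+ b) R.* coeff p n                ≈⟨ R.distribʳ _ _ _ ⟩
    a R.* coeff p n R.+ b R.* coeff p n    ≈⟨ R.+-cong (coeff-· a p n) (coeff-· b p n) ⟨
    coeff (a · p) n R.+ coeff (b · p) n    ≈⟨ coeff-+ (a · p) (b · p) n ⟨
    coeff (a · p + b · p) n                ∎
    where open SetoidReasoning R.setoid

  ·-assoc : ∀ a b p → (a R.* b) · p ≈ a · (b · p)
  at (·-assoc a b p) n = begin
    coeff ((a R.* b) · p) n     ≈⟨ coeff-· _ p n ⟩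
    (a R.* b) R.* coeff p n     ≈⟨ R.*-assoc _ _ _ ⟩
    a R.* (b R.* coeff p n)     ≈⟨ R.*-congˡ (coeff-· b p n) ⟨
    a R.* coeff (b · p) n       ≈⟨ coeff-· a (b · p) n ⟨
    coeff (a · (b · p)) n       ∎
    where open SetoidReasoning R.setoid

  *-congˡ : ∀ p {q r} → q ≈ r → p * q ≈ p * r
  *-congˡ []      e = ≈-refl
  *-congˡ (a ∷ p) e = +-cong (·-cong R.refl e) (∷-cong R.refl (*-congˡ p e))

  *-zeroʳ : ∀ p → p * 0# ≈ 0#
  *-zeroʳ []      = ≈-refl
  *-zeroʳ (a ∷ p) = ∷≈0 R.refl (*-zeroʳ p)

  *-∷ : ∀ p b q → p * (b ∷ q) ≈ b · p + (R.0# ∷ p * q)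
  *-∷ []      b q = ≈-sym (∷≈0 R.refl ≈-refl)
  *-∷ (a ∷ p) b q = ∷-cong (R.+-congʳ (R.*-comm a b)) (begin
    a · q + p * (b ∷ q)                 ≈⟨ +-cong ≈-refl (*-∷ p b q) ⟩
    a · q + (b · p + (R.0# ∷ p * q))    ≈⟨ +-assoc (a · q) (b · p) _ ⟨
    a · q + b · p + (R.0# ∷ p * q)      ≈⟨ +-cong (+-comm (a · q) (b · p)) ≈-refl ⟩
    b · p + a · q + (R.0# ∷ p * q)      ≈⟨ +-assoc (b · p) (a · q) _ ⟩
    b · p + (a · q + (R.0# ∷ p * q))    ∎)
    where open SetoidReasoning ≈-setoid

  *-comm : ∀ p q → p * q ≈ q * p
  *-comm []      q = ≈-sym (*-zeroʳ q)
  *-comm (a ∷ p) q = begin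
    a · q + (R.0# ∷ p * q)    ≈⟨ +-cong ≈-refl (∷-cong R.refl (*-comm p q)) ⟩
    a · q + (R.0# ∷ q * p)    ≈⟨ *-∷ q a p ⟨
    q * (a ∷ p)               ∎
    where open SetoidReasoning ≈-setoid

  *-cong : ∀ {p p′ q q′} → p ≈ p′ → q ≈ q′ → p * q ≈ p′ * q′
  *-cong {p} {p′} {q} {q′} e f = begin
    p * q      ≈⟨ *-congˡ p f ⟩
    p * q′     ≈⟨ *-comm p q′ ⟩
    q′ * p     ≈⟨ *-congˡ q′ e ⟩
    q′ * p′    ≈⟨ *-comm q′ p′ ⟩
    p′ * q′    ∎
    where open SetoidReasoning ≈-setoid

  distribˡ : ∀ p q r → p * (q + r) ≈ p * q + p * r
  distribˡ []      q r = ≈-refl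
  distribˡ (a ∷ p) q r = begin
    a · (q + r) + (R.0# ∷ p * (q + r))
      ≈⟨ +-cong (·-distribˡ a q r)
                (≈-trans (∷-cong R.refl (distribˡ p q r)) (0∷-+ (p * q) (p * r))) ⟩
    (a · q + a · r) + ((R.0# ∷ p * q) + (R.0# ∷ p * r))
      ≈⟨ +-interchange (a · q) (a · r) _ _ ⟩
    (a ∷ p) * q + (a ∷ p) * r
      ∎
    where open SetoidReasoning ≈-setoid

  distribʳ : ∀ p q r → (q + r) * p ≈ q * p + r * p
  distribʳ p q r = begin
    (q + r) * p      ≈⟨ *-comm (q + r) p ⟩
    p * (q + r)      ≈⟨ distribˡ p q r ⟩
    p * q + p * r    ≈⟨ +-cong (*-comm p q) (*-comm p r) ⟩
    q * p + r * p    ∎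
    where open SetoidReasoning ≈-setoid

  ·-*-assoc : ∀ a p q → (a · p) * q ≈ a · (p * q)
  ·-*-assoc a []      q = ≈-refl
  ·-*-assoc a (b ∷ p) q = begin
    (a R.* b) · q + (R.0# ∷ (a · p) * q)
      ≈⟨ +-cong (·-assoc a b q) (∷-cong (R.sym (R.zeroʳ a)) (·-*-assoc a p q)) ⟩
    a · (b · q) + a · (R.0# ∷ p * q)
      ≈⟨ ·-distribˡ a (b · q) _ ⟨
    a · ((b ∷ p) * q)
      ∎
    where open SetoidReasoning ≈-setoid

  0∷-*-assoc : ∀ p q → (R.0# ∷ p) * q ≈ R.0# ∷ p * q
  0∷-*-assoc p q = +-cong (·-zeroˡ q) ≈-refl

  *-assoc : ∀ p q r → (p * q) * r ≈ p * (q * r)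
  *-assoc []      q r = ≈-refl
  *-assoc (a ∷ p) q r = begin
    (a · q + (R.0# ∷ p * q)) * r
      ≈⟨ distribʳ r (a · q) _ ⟩
    (a · q) * r + (R.0# ∷ p * q) * r
      ≈⟨ +-cong (·-*-assoc a q r)
                (≈-trans (0∷-*-assoc (p * q) r) (∷-cong R.refl (*-assoc p q r))) ⟩
    a · (q * r) + (R.0# ∷ p * (q * r))
      ∎
    where open SetoidReasoning ≈-setoid

  const-* : ∀ a p → const a * p ≈ a · p
  const-* a p = ≈-trans (+-cong ≈-refl (∷≈0 R.refl ≈-refl)) (+-identityʳ (a · p))

  *-identityˡ : ∀ p → 1# * p ≈ p
  *-identityˡ p = ≈-trans (const-* R.1# p) (·-identityˡ p)

  commutativeRing : CommutativeRing c ℓ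
  commutativeRing = record
    { Carrier = Poly ; _≈_ = _≈_ ; _+_ = _+_ ; _*_ = _*_ ; -_ = -_ ; 0# = 0# ; 1# = 1#
    ; isCommutativeRing = record
      { isRing = record
        { +-isAbelianGroup = record
          { isGroup = record
            { isMonoid = record
              { isSemigroup = record
                { isMagma = record { isEquivalence = ≈-isEquivalence ; ∙-cong = +-cong }
                ; assoc   = +-assoc
                }
              ; identity = +-identityˡ , +-identityʳ
              }
            ; inverse = -‿inverseˡ , -‿inverseʳ
            ; ⁻¹-cong = -‿cong
            }
          ; comm = +-comm
          }
        ; *-cong     = *-cong
        ; *-assoc    = *-assoc
        ; *-identity = *-identityˡ , λ p → ≈-trans (*-comm p 1#) (*-identityˡ p)
        ; distrib    = distribˡ , distribʳ
        }
      ; *-comm = *-comm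
      }
    }

  VanishesFrom : ℕ → Poly → Set ℓ
  VanishesFrom n p = ∀ k → n ℕ.≤ k → coeff p k R.≈ R.0#

  *-zeroˡ′ : ∀ p q → p ≈ 0# → p * q ≈ 0#
  *-zeroˡ′ p q e = *-cong e (≈-refl {q})

  coeff-∷-* : ∀ a p q k →
              coeff ((a ∷ p) * q) (suc k) R.≈ a R.* coeff q (suc k) R.+ coeff (p * q) k
  coeff-∷-* a p q k =
    R.trans (coeff-+ (a · q) _ (suc k)) (R.+-congʳ (coeff-· a q (suc k)))

  *-vanishes : ∀ {m n} p q → VanishesFrom (suc m) p → VanishesFrom (suc n) q →
               VanishesFrom (suc (m ℕ.+ n)) (p * q)
  *-vanishes         []      q vp vq k       _         = R.refl
  *-vanishes {m} {n} (a ∷ p) q vp vq (suc k) (s≤s m+n≤k) = begin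
    coeff ((a ∷ p) * q) (suc k)                  ≈⟨ coeff-∷-* a p q k ⟩
    a R.* coeff q (suc k) R.+ coeff (p * q) k    ≈⟨ R.+-cong (R.*-congˡ vq′) (rest m vp m+n≤k) ⟩
    a R.* R.0# R.+ R.0#                          ≈⟨ R.+-identityʳ _ ⟩
    a R.* R.0#                                   ≈⟨ R.zeroʳ a ⟩
    R.0#                                         ∎
    where
    open SetoidReasoning R.setoid
    vq′ : coeff q (suc k) R.≈ R.0#
    vq′ = vq (suc k) (s≤s (ℕ.≤-trans (ℕ.m≤n+m n m) m+n≤k))
    rest : ∀ m → VanishesFrom (suc m) (a ∷ p) → m ℕ.+ n ℕ.≤ k → coeff (p * q) k R.≈ R.0#
    rest zero    v _ = at (*-zeroˡ′ p q (mk≈ λ j → v (suc j) (s≤s z≤n))) k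
    rest (suc m) v l = *-vanishes p q (λ j m<j → v (suc j) (s≤s m<j)) vq k l

  *-leading : ∀ {m n} p q → VanishesFrom (suc m) p → VanishesFrom (suc n) q →
              coeff (p * q) (m ℕ.+ n) R.≈ coeff p m R.* coeff q n
  *-leading                 []      q vp vq = R.sym (R.zeroˡ _)
  *-leading {zero}  {n}     (a ∷ p) q vp vq = begin
    coeff (a · q + (R.0# ∷ p * q)) n    ≈⟨ at (+-cong (≈-refl {a · q}) 0∷pq≈0) n ⟩
    coeff (a · q + 0#) n                ≈⟨ at (+-identityʳ (a · q)) n ⟩
    coeff (a · q) n                     ≈⟨ coeff-· a q n ⟩
    a R.* coeff q n                     ∎
    where
    open SetoidReasoning R.setoid
    0∷pq≈0 : R.0# ∷ p * q ≈ 0#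
    0∷pq≈0 = ∷≈0 R.refl (*-zeroˡ′ p q (mk≈ λ j → vp (suc j) (s≤s z≤n)))
  *-leading {suc m} {n} (a ∷ p) q vp vq = begin
    coeff ((a ∷ p) * q) (suc (m ℕ.+ n))
      ≈⟨ coeff-∷-* a p q (m ℕ.+ n) ⟩
    a R.* coeff q (suc (m ℕ.+ n)) R.+ coeff (p * q) (m ℕ.+ n)
      ≈⟨ R.+-cong (R.*-congˡ (vq _ (s≤s (ℕ.m≤n+m n m))))
                  (*-leading p q (λ j m<j → vp (suc j) (s≤s m<j)) vq) ⟩
    a R.* R.0# R.+ coeff p m R.* coeff q n
      ≈⟨ R.+-congʳ (R.zeroʳ a) ⟩
    R.0# R.+ coeff p m R.* coeff q n
      ≈⟨ R.+-identityˡ _ ⟩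
    coeff p m R.* coeff q n
      ∎
    where open SetoidReasoning R.setoid

module Residues {c ℓ} (R : CommutativeRing c ℓ) where

  open CommutativeRing R
  open Divisibility semiring using (_∣_; _∣0; ∣-respʳ)
  open RingProperties ring
  open AbelianGroupProperties +-abelianGroup using () renaming (⁻¹-anti-homo‿- to -[x-y]≈y-x)

  infix 4 _≡_[mod_]

  _≡_[mod_] : Carrier → Carrier → Carrier → Set (c ⊔ ℓ)
  a ≡ b [mod h ] = h ∣ a - b

  ∣-+ : ∀ {h a b} → h ∣ a → h ∣ b → h ∣ a + b
  ∣-+ {h} (u , uh≈a) (v , vh≈b) =
    u + v , trans (distribʳ h u v) (+-cong uh≈a vh≈b)

  ∣-neg : ∀ {h a} → h ∣ a → h ∣ - a
  ∣-neg {h} (u , uh≈a) =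
    - u , trans (sym (-‿distribˡ-* u h)) (-‿cong uh≈a)

  telescope : ∀ a b d → (a - b) + (b - d) ≈ a - d
  telescope a b d = begin
    (a - b) + (b - d)      ≈⟨ +-assoc a (- b) (b - d) ⟩
    a + (- b + (b - d))    ≈⟨ +-congˡ (+-assoc (- b) b (- d)) ⟨
    a + ((- b + b) - d)    ≈⟨ +-congˡ (+-congʳ (-‿inverseˡ b)) ⟩
    a + (0# - d)           ≈⟨ +-congˡ (+-identityˡ (- d)) ⟩
    a - d                  ∎
    where open SetoidReasoning setoid

  -- The underlying set of R / h R; its ring structure is not needed.

  Residue : Carrier → Setoid c (c ⊔ ℓ)
  Residue h = record
    { Carrier = Carrier
    ; _≈_     = λ a b → a ≡ b [mod h ]
    ; isEquivalence = record
      { refl  = λ {a} → ∣-respʳ (sym (-‿inverseʳ a)) (h ∣0)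
      ; sym   = λ {a} {b} e → ∣-respʳ (-[x-y]≈y-x a b) (∣-neg e)
      ; trans = λ {a} {b} {d} e f → ∣-respʳ (telescope a b d) (∣-+ e f)
      }
    }

PrimePower : ℕ → Set
PrimePower q = ∃[ p ] ∃[ k ] ℕ.Prime p × 1 ℕ.≤ k × q ≡ p ℕ.^ k

record FiniteField c ℓ (q : ℕ) : Set (lsuc (c ⊔ ℓ)) where
  field
    commutativeRing : CommutativeRing c ℓ

  open CommutativeRing commutativeRing public

  field
    1≉0         : 1# ≉ 0#
    inverse     : ∀ {x} → x ≉ 0# → Invertible _≈_ 1# _*_ x
    enumeration : Inverse setoid (≡.setoid (Fin q))

  infix 4 _≟_

  _≟_ : ∀ x y → Dec (x ≈ y)
  x ≟ y = map′ injective (Inverse.to-cong enumeration) (to x Fin.≟ to y)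
    where
    open Inverse enumeration using (to; inverseʳ)
    injective : to x ≡ to y → x ≈ y
    injective e = trans (sym (inverseʳ ≡.refl)) (inverseʳ e)

module 𝔽[t] {c ℓ q} (F : FiniteField c ℓ q) where

  private
    module F = FiniteField F
    module P = Polynomial F.commutativeRing
    module Enumeration = Inverse F.enumeration

  open P public using (Poly; coeff; const)
  open P using (mk≈; at; _·_; ∷-cong; ∷≈0; tail≈0; coeff-·; const-*; VanishesFrom;
                *-vanishes; *-leading)

  𝔸 : CommutativeRing c ℓ
  𝔸 = P.commutativeRing

  open CommutativeRing 𝔸
  open Divisibility semiring using (_∣_; _∤_; ∣-trans; ∣-respˡ; x∣yx)
  open CommutativeSemigroupProperties *-commutativeSemigroup using (interchange; x∙yz≈y∙xz)
  open Exp semiring using (_^_; ^-homo-*; ^-congˡ)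
  open Primality semiring using (Irreducible; mkIrred)
  open SetoidReasoning setoid

  infix 4 _≟0 _≟_

  _≟0 : ∀ p → Dec (p ≈ 0#)
  []      ≟0 = yes refl
  (a ∷ p) ≟0 = map′ (λ (a≈0 , p≈0) → ∷≈0 a≈0 p≈0) (λ e → at e 0 , tail≈0 e)
                 ((a F.≟ F.0#) ×-dec (p ≟0))

  _≟_ : ∀ p r → Dec (p ≈ r)
  []      ≟ r       = map′ sym sym (r ≟0)
  (a ∷ p) ≟ []      = (a ∷ p) ≟0
  (a ∷ p) ≟ (b ∷ r) = map′ (λ (a≈b , p≈r) → ∷-cong a≈b p≈r)
                        (λ e → at e 0 , mk≈ (λ n → at e (suc n)))
                        ((a F.≟ b) ×-dec (p ≟ r))

  -- The zero polynomial gets degree 0, like the non-zero constants.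

  deg : Poly → ℕ
  deg []      = 0
  deg (a ∷ p) with p ≟0
  ... | yes _ = 0
  ... | no  _ = suc (deg p)

  leading : Poly → F.Carrier
  leading p = coeff p (deg p)

  NonConstant : Poly → Set
  NonConstant p = 1 ℕ.≤ deg p

  Monic : Poly → Set ℓ
  Monic p = leading p F.≈ F.1#

  deg-vanishes : ∀ p → VanishesFrom (suc (deg p)) p
  deg-vanishes []      k       _ = F.refl
  deg-vanishes (a ∷ p) k       l with p ≟0
  deg-vanishes (a ∷ p) (suc k) l       | yes p≈0 = at p≈0 k
  deg-vanishes (a ∷ p) (suc k) (s≤s l) | no  _   = deg-vanishes p k l

  leading≉0 : ∀ p → p ≉ 0# → leading p F.≉ F.0#
  leading≉0 []      p≉0 _ = p≉0 refl
  leading≉0 (a ∷ p) ap≉0 with p ≟0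
  ... | yes p≈0 = λ a≈0 → ap≉0 (∷≈0 a≈0 p≈0)
  ... | no  p≉0 = leading≉0 p p≉0

  deg-unique : ∀ p n → VanishesFrom (suc n) p → coeff p n F.≉ F.0# → deg p ≡ n
  deg-unique p n v pₙ≉0 with ℕ.<-cmp (deg p) n
  ... | tri≈ _ e _ = e
  ... | tri< l _ _ = contradiction (deg-vanishes p n l) pₙ≉0
  ... | tri> _ _ g = contradiction (v (deg p) g) (leading≉0 p (λ e → pₙ≉0 (at e n)))

  deg-0 : ∀ p → p ≈ 0# → deg p ≡ 0
  deg-0 []      _ = ≡.refl
  deg-0 (a ∷ p) e with p ≟0
  ... | yes _   = ≡.refl
  ... | no  p≉0 = contradiction (tail≈0 e) p≉0

  deg-cong : ∀ {p r} → p ≈ r → deg p ≡ deg r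
  deg-cong {p} {r} e with r ≟0
  ... | yes r≈0 = ≡.trans (deg-0 p (trans e r≈0)) (≡.sym (deg-0 r r≈0))
  ... | no  r≉0 = deg-unique p (deg r)
    (λ k l → F.trans (at e k) (deg-vanishes r k l))
    (λ pₙ≈0 → leading≉0 r r≉0 (F.trans (F.sym (at e (deg r))) pₙ≈0))

  NonConstant⇒≉0 : ∀ {p} → NonConstant p → p ≉ 0#
  NonConstant⇒≉0 {p} nc p≈0 with ≡.subst (1 ℕ.≤_) (deg-0 p p≈0) nc
  ... | ()

  F-cancel : ∀ {a b} → a F.≉ F.0# → a F.* b F.≈ F.0# → b F.≈ F.0#
  F-cancel {a} {b} a≉0 ab≈0 = let (a⁻¹ , a⁻¹a≈1 , _) = F.inverse a≉0 in
    F.trans (F.sym (F.*-identityˡ b)) (F.trans (F.*-congʳ (F.sym a⁻¹a≈1))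
      (F.trans (F.*-assoc a⁻¹ a b) (F.trans (F.*-congˡ ab≈0) (F.zeroʳ a⁻¹))))

  private
    product≉0 : ∀ p r → p ≉ 0# → r ≉ 0# → coeff (p * r) (deg p ℕ.+ deg r) F.≉ F.0#
    product≉0 p r p≉0 r≉0 e = leading≉0 r r≉0 (F-cancel (leading≉0 p p≉0)
      (F.trans (F.sym (*-leading p r (deg-vanishes p) (deg-vanishes r))) e))

  *≉0 : ∀ p r → p ≉ 0# → r ≉ 0# → p * r ≉ 0#
  *≉0 p r p≉0 r≉0 e = product≉0 p r p≉0 r≉0 (at e _)

  deg-* : ∀ p r → p ≉ 0# → r ≉ 0# → deg (p * r) ≡ deg p ℕ.+ deg r
  deg-* p r p≉0 r≉0 = deg-unique (p * r) _
    (*-vanishes p r (deg-vanishes p) (deg-vanishes r)) (product≉0 p r p≉0 r≉0)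

  1≉0 : 1# ≉ 0#
  1≉0 e = F.1≉0 (at e 0)

  const≉0 : ∀ {a} → a F.≉ F.0# → const a ≉ 0#
  const≉0 a≉0 e = a≉0 (at e 0)

  const-*-const : ∀ a b → const a * const b ≈ const (a F.* b)
  const-*-const a b = const-* a (const b)

  deg-0⇒const : ∀ p → deg p ≡ 0 → p ≈ const (leading p)
  deg-0⇒const p e = mk≈ helper
    where
    helper : ∀ n → coeff p n F.≈ coeff (const (leading p)) n
    helper zero    = F.reflexive (≡.cong (coeff p) (≡.sym e))
    helper (suc n) = deg-vanishes p (suc n) (≡.subst (ℕ._< suc n) (≡.sym e) (s≤s z≤n))

  const∣1 : ∀ {a} → a F.≉ F.0# → const a ∣ 1#
  const∣1 {a} a≉0 = let (a⁻¹ , a⁻¹a≈1 , _) = F.inverse a≉0 in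
    const a⁻¹ , trans (const-*-const a⁻¹ a) (∷-cong a⁻¹a≈1 refl)

  deg-0⇒∣1 : ∀ p → p ≉ 0# → deg p ≡ 0 → p ∣ 1#
  deg-0⇒∣1 p p≉0 e = ∣-respˡ (sym (deg-0⇒const p e)) (const∣1 (leading≉0 p p≉0))

  NonConstant⇒∤1 : ∀ {p} → NonConstant p → p ∤ 1#
  NonConstant⇒∤1 {p} nc (u , up≈1) =
    ℕ.<⇒≱ nc (ℕ.≤-trans (ℕ.m≤n+m (deg p) (deg u)) (ℕ.≤-reflexive
      (≡.trans (≡.sym (deg-* u p u≉0 (NonConstant⇒≉0 nc))) (deg-cong up≈1))))
    where
    u≉0 : u ≉ 0#
    u≉0 u≈0 = 1≉0 (trans (sym up≈1) (trans (*-congʳ u≈0) (zeroˡ p)))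

  below : ℕ → List Poly
  below zero    = [] ∷ []
  below (suc n) = cartesianProductWith _∷_ (map Enumeration.from (allFin q)) (below n)

  below-complete : ∀ n p → VanishesFrom n p → ∃[ p′ ] p′ ∈ below n × p′ ≈ p
  below-complete zero    p v = [] , here ≡.refl , mk≈ (λ k → F.sym (v k z≤n))
  below-complete (suc n) p v =
    let (p′ , p′∈ , p′≈) = below-complete n (tail p) (tail-vanishes p v) in
      Enumeration.from (Enumeration.to (coeff p 0)) ∷ p′
    , ∈-cartesianProductWith⁺ _∷_ (∈-map⁺ Enumeration.from (∈-allFin _)) p′∈
    , trans (∷-cong (Enumeration.inverseʳ ≡.refl) p′≈) (head∷tail p)
    where
    tail : Poly → Poly
    tail []      = []
    tail (a ∷ p) = p
    tail-vanishes : ∀ p → VanishesFrom (suc n) p → VanishesFrom n (tail p)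
    tail-vanishes []      v k l = F.refl
    tail-vanishes (a ∷ p) v k l = v (suc k) (s≤s l)
    head∷tail : ∀ p → coeff p 0 ∷ tail p ≈ p
    head∷tail []      = ∷≈0 F.refl refl
    head∷tail (a ∷ p) = refl

  Splits : Poly → Set (c ⊔ ℓ)
  Splits p = ∃[ a ] ∃[ b ] NonConstant a × NonConstant b × a * b ≈ p

  split-deg : ∀ {p} a b → NonConstant a → NonConstant b → a * b ≈ p →
              deg a ℕ.+ deg b ≡ deg p
  split-deg {p} a b na nb e = ≡.trans
    (≡.sym (deg-* a b (NonConstant⇒≉0 {a} na) (NonConstant⇒≉0 {b} nb))) (deg-cong e)

  splits? : ∀ p → Dec (Splits p)
  splits? p = map′ sound complete
    (any? (λ a → any? (λ b → (1 ℕ.≤? deg a) ×-dec (1 ℕ.≤? deg b) ×-dec (a * b ≟ p)) ps) ps)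
    where
    ps = below (suc (deg p))

    sound : _ → Splits p
    sound x = let (a , y) = satisfied x ; (b , z) = satisfied y in a , b , z

    small : ∀ a → deg a ℕ.≤ deg p → ∃[ a′ ] a′ ∈ ps × a′ ≈ a
    small a l = below-complete (suc (deg p)) a
      (λ k m → deg-vanishes a k (ℕ.≤-trans (s≤s l) m))

    complete : Splits p → _
    complete (a , b , na , nb , e) =
      let d              = split-deg {p} a b na nb e
          (a′ , a∈ , a≈) = small a (≡.subst (deg a ℕ.≤_) d (ℕ.m≤m+n _ _))
          (b′ , b∈ , b≈) = small b (≡.subst (deg b ℕ.≤_) d (ℕ.m≤n+m _ _))
      in lose a∈ (lose b∈
           ( ≡.subst (1 ℕ.≤_) (≡.sym (deg-cong {a′} {a} a≈)) na
           , ≡.subst (1 ℕ.≤_) (≡.sym (deg-cong {b′} {b} b≈)) nb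
           , trans (*-cong a≈ b≈) e))

  ¬Splits⇒Irreducible : ∀ {p} → NonConstant p → ¬ Splits p → Irreducible p
  ¬Splits⇒Irreducible {p} np ¬s = mkIrred (NonConstant⇒∤1 np) split
    where
    split : ∀ {x y} → p ≈ x * y → x ∣ 1# ⊎ y ∣ 1#
    split {x} {y} e with 1 ℕ.≤? deg x | 1 ℕ.≤? deg y
    ... | yes nx | yes ny = contradiction (x , y , nx , ny , sym e) ¬s
    ... | no  cx | _      = inj₁ (deg-0⇒∣1 x
      (λ x≈0 → NonConstant⇒≉0 np (trans e (trans (*-congʳ x≈0) (zeroˡ y))))
      (ℕ.n<1⇒n≡0 (ℕ.≰⇒> cx)))
    ... | _      | no  cy = inj₂ (deg-0⇒∣1 y
      (λ y≈0 → NonConstant⇒≉0 np (trans e (trans (*-congˡ {x} y≈0) (zeroʳ x))))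
      (ℕ.n<1⇒n≡0 (ℕ.≰⇒> cy)))

  ∏ : List (Poly × ℕ) → Poly
  ∏ []             = 1#
  ∏ ((Q , k) ∷ fs) = Q ^ k * ∏ fs

  PrimeFactor : Poly × ℕ → Set (c ⊔ ℓ)
  PrimeFactor (Q , k) = Monic Q × Irreducible Q × 1 ℕ.≤ k

  Distinct : Poly × ℕ → Poly × ℕ → Set ℓ
  Distinct (Q , _) (Q′ , _) = Q ≉ Q′

  record Factorisation (h : Poly) : Set (c ⊔ ℓ) where
    field
      unit         : F.Carrier
      unit≉0       : unit F.≉ F.0#
      factors      : List (Poly × ℕ)
      primeFactors : All PrimeFactor factors
      distinct     : AllPairs Distinct factors
      factorises   : h ≈ const unit * ∏ factors

  insert : Poly → ℕ → List (Poly × ℕ) → List (Poly × ℕ)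
  insert Q k []               = (Q , k) ∷ []
  insert Q k ((Q′ , k′) ∷ fs) with Q ≟ Q′
  ... | yes _ = (Q′ , k ℕ.+ k′) ∷ fs
  ... | no  _ = (Q′ , k′) ∷ insert Q k fs

  ∏-insert : ∀ Q k fs → ∏ (insert Q k fs) ≈ Q ^ k * ∏ fs
  ∏-insert Q k []               = refl
  ∏-insert Q k ((Q′ , k′) ∷ fs) with Q ≟ Q′
  ... | yes Q≈Q′ = begin
    Q′ ^ (k ℕ.+ k′) * ∏ fs       ≈⟨ *-congʳ (^-homo-* Q′ k k′) ⟩
    Q′ ^ k * Q′ ^ k′ * ∏ fs      ≈⟨ *-assoc (Q′ ^ k) (Q′ ^ k′) (∏ fs) ⟩
    Q′ ^ k * (Q′ ^ k′ * ∏ fs)    ≈⟨ *-congʳ (^-congˡ k Q≈Q′) ⟨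
    Q ^ k * (Q′ ^ k′ * ∏ fs)     ∎
  ... | no  _    = begin
    Q′ ^ k′ * ∏ (insert Q k fs)  ≈⟨ *-congˡ {Q′ ^ k′} (∏-insert Q k fs) ⟩
    Q′ ^ k′ * (Q ^ k * ∏ fs)     ≈⟨ x∙yz≈y∙xz (Q′ ^ k′) (Q ^ k) (∏ fs) ⟩
    Q ^ k * (Q′ ^ k′ * ∏ fs)     ∎

  insert-primeFactors : ∀ Q k {fs} → PrimeFactor (Q , k) → All PrimeFactor fs →
                        All PrimeFactor (insert Q k fs)
  insert-primeFactors Q k {[]}             pf []                   = pf ∷ []
  insert-primeFactors Q k {(Q′ , k′) ∷ fs} pf ((m , i , 1≤k′) ∷ pfs) with Q ≟ Q′
  ... | yes _ = (m , i , ℕ.≤-trans 1≤k′ (ℕ.m≤n+m k′ k)) ∷ pfs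
  ... | no  _ = (m , i , 1≤k′) ∷ insert-primeFactors Q k pf pfs

  insert-apart : ∀ Q k R j {fs} → R ≉ Q → All (Distinct (R , j)) fs →
                 All (Distinct (R , j)) (insert Q k fs)
  insert-apart Q k R j {[]}             R≉Q []       = R≉Q ∷ []
  insert-apart Q k R j {(Q′ , k′) ∷ fs} R≉Q (d ∷ ds) with Q ≟ Q′
  ... | yes _ = d ∷ ds
  ... | no  _ = d ∷ insert-apart Q k R j R≉Q ds

  insert-distinct : ∀ Q k {fs} → AllPairs Distinct fs → AllPairs Distinct (insert Q k fs)
  insert-distinct Q k {[]}             []       = [] ∷ []
  insert-distinct Q k {(Q′ , k′) ∷ fs} (d ∷ ds) with Q ≟ Q′
  ... | yes _    = d ∷ ds
  ... | no  Q≉Q′ = insert-apart Q k Q′ k′ (Q≉Q′ ∘ sym) d ∷ insert-distinct Q k ds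

  merge : List (Poly × ℕ) → List (Poly × ℕ) → List (Poly × ℕ)
  merge []             gs = gs
  merge ((Q , k) ∷ fs) gs = insert Q k (merge fs gs)

  ∏-merge : ∀ fs gs → ∏ (merge fs gs) ≈ ∏ fs * ∏ gs
  ∏-merge []             gs = sym (*-identityˡ (∏ gs))
  ∏-merge ((Q , k) ∷ fs) gs = begin
    ∏ (insert Q k (merge fs gs))  ≈⟨ ∏-insert Q k (merge fs gs) ⟩
    Q ^ k * ∏ (merge fs gs)       ≈⟨ *-congˡ {Q ^ k} (∏-merge fs gs) ⟩
    Q ^ k * (∏ fs * ∏ gs)         ≈⟨ *-assoc (Q ^ k) (∏ fs) (∏ gs) ⟨
    Q ^ k * ∏ fs * ∏ gs           ∎

  merge-primeFactors : ∀ {fs gs} → All PrimeFactor fs → All PrimeFactor gs →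
                       All PrimeFactor (merge fs gs)
  merge-primeFactors []         qs = qs
  merge-primeFactors (pf ∷ pfs) qs = insert-primeFactors _ _ pf (merge-primeFactors pfs qs)

  merge-distinct : ∀ fs {gs} → AllPairs Distinct gs → AllPairs Distinct (merge fs gs)
  merge-distinct []             ds = ds
  merge-distinct ((Q , k) ∷ fs) ds = insert-distinct Q k (merge-distinct fs ds)

  factorise-const : ∀ p → p ≉ 0# → deg p ≡ 0 → Factorisation p
  factorise-const p p≉0 e = record
    { unit         = leading p
    ; unit≉0       = leading≉0 p p≉0
    ; factors      = []
    ; primeFactors = []
    ; distinct     = []
    ; factorises   = trans (deg-0⇒const p e) (sym (*-identityʳ (const (leading p))))
    }

  factorise-irreducible : ∀ p → p ≉ 0# → Irreducible p → Factorisation p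
  factorise-irreducible p p≉0 (mkIrred p∤1 split) = record
    { unit         = a
    ; unit≉0       = a≉0
    ; factors      = (Q , 1) ∷ []
    ; primeFactors = (monic , mkIrred Q∤1 split′ , ℕ.≤-refl) ∷ []
    ; distinct     = [] ∷ []
    ; factorises   = trans p≈aQ (*-congˡ {const a}
        (sym (trans (*-identityʳ (Q ^ 1)) (*-identityʳ Q))))
    }
    where
    a   = leading p
    a≉0 = leading≉0 p p≉0
    b   = proj₁ (F.inverse a≉0)
    ba≈1 : b F.* a F.≈ F.1#
    ba≈1 = proj₁ (proj₂ (F.inverse a≉0))
    b≉0 : b F.≉ F.0#
    b≉0 b≈0 = F.1≉0 (F.trans (F.sym ba≈1) (F.trans (F.*-congʳ b≈0) (F.zeroˡ a)))
    Q   = const b * p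

    const-ab≈1 : const (a F.* b) ≈ 1#
    const-ab≈1 = ∷-cong (F.trans (F.*-comm a b) ba≈1) refl

    p≈aQ : p ≈ const a * Q
    p≈aQ = begin
      p                        ≈⟨ *-identityˡ p ⟨
      1# * p                   ≈⟨ *-congʳ {p} const-ab≈1 ⟨
      const (a F.* b) * p      ≈⟨ *-congʳ (const-*-const a b) ⟨
      const a * const b * p    ≈⟨ *-assoc (const a) (const b) p ⟩
      const a * Q              ∎

    monic : Monic Q
    monic = F.trans (F.reflexive (≡.cong (coeff Q) (deg-* (const b) p (const≉0 b≉0) p≉0)))
      (F.trans (at (const-* b p) (deg p)) (F.trans (coeff-· b p (deg p)) ba≈1))

    Q∤1 : Q ∤ 1#
    Q∤1 Q∣1 = p∤1 (∣-trans (x∣yx p (const b)) Q∣1)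

    split′ : ∀ {x y} → Q ≈ x * y → x ∣ 1# ⊎ y ∣ 1#
    split′ {x} {y} e with split
      (trans p≈aQ (trans (*-congˡ {const a} e) (sym (*-assoc (const a) x y))))
    ... | inj₁ ax∣1 = inj₁ (∣-trans (x∣yx x (const a)) ax∣1)
    ... | inj₂ y∣1  = inj₂ y∣1

  factorise-* : ∀ {p r s} → r * s ≈ p → Factorisation r → Factorisation s → Factorisation p
  factorise-* {p} {r} {s} rs≈p R S = record
    { unit         = R.unit F.* S.unit
    ; unit≉0       = λ e → S.unit≉0 (F-cancel R.unit≉0 e)
    ; factors      = merge R.factors S.factors
    ; primeFactors = merge-primeFactors R.primeFactors S.primeFactors
    ; distinct     = merge-distinct R.factors S.distinct
    ; factorises   = begin
        p
          ≈⟨ rs≈p ⟨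
        r * s
          ≈⟨ *-cong R.factorises S.factorises ⟩
        (const R.unit * ∏ R.factors) * (const S.unit * ∏ S.factors)
          ≈⟨ interchange (const R.unit) (∏ R.factors) (const S.unit) (∏ S.factors) ⟩
        (const R.unit * const S.unit) * (∏ R.factors * ∏ S.factors)
          ≈⟨ *-cong (sym (const-*-const R.unit S.unit)) (∏-merge R.factors S.factors) ⟨
        const (R.unit F.* S.unit) * ∏ (merge R.factors S.factors)
          ∎
    }
    where
    module R = Factorisation R
    module S = Factorisation S

  factorise : ∀ p → p ≉ 0# → Factorisation p
  factorise p = go (deg p) p ℕ.≤-refl
    where
    go : ∀ n p → deg p ℕ.≤ n → p ≉ 0# → Factorisation p
    go zero    p l p≉0 = factorise-const p p≉0 (ℕ.n≤0⇒n≡0 l)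
    go (suc n) p l p≉0 with 1 ℕ.≤? deg p
    ... | no  c  = factorise-const p p≉0 (ℕ.n<1⇒n≡0 (ℕ.≰⇒> c))
    ... | yes np with splits? p
    ... | no  ¬s = factorise-irreducible p p≉0 (¬Splits⇒Irreducible np ¬s)
    ... | yes (r , s , nr , ns , e) = factorise-* e
      (go n r (smaller (ℕ.m<m+n (deg r) ns)) (NonConstant⇒≉0 {r} nr))
      (go n s (smaller (ℕ.m<n+m (deg s) nr)) (NonConstant⇒≉0 {s} ns))
      where
      smaller : ∀ {d} → d ℕ.< deg r ℕ.+ deg s → d ℕ.≤ n
      smaller d< = s≤s⁻¹ (ℕ.≤-trans d<
        (ℕ.≤-trans (ℕ.≤-reflexive (split-deg r s nr ns e)) l))

_⊓⁺_ : ℕ ⁺ → ℕ ⁺ → ℕ ⁺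
⊤⁺    ⊓⁺ n     = n
[ m ] ⊓⁺ ⊤⁺    = [ m ]
[ m ] ⊓⁺ [ n ] = [ m ℕ.⊓ n ]

-- γ (P ^ e) over 𝔽_q for irreducible P of degree d and e ≥ 1.

γ-primePower : (q d e : ℕ) → ℕ ⁺
γ-primePower 2 d 1 = ⊤⁺
γ-primePower 2 1 2 = ⊤⁺
γ-primePower 2 d e = [ d ℕ.+ 2 ]
γ-primePower q d 1 = ⊤⁺
γ-primePower q d e = [ d ℕ.+ 1 ]

module _ {c ℓ q} (F : FiniteField c ℓ q) where

  open 𝔽[t] F

  -- For h = P ^ e the factorisation has one factor, of degree deg P and
  -- exponent e, and the minimum is γ-primePower q (deg P) e.  As h is
  -- not constant there is a factor, so ⊤⁺ only ends the recursion.

  γ : (h : Poly) → NonConstant h → ℕ ⁺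
  γ h nc = foldr (λ (Q , k) m → γ-primePower q (deg Q) k ⊓⁺ m) ⊤⁺
             (Factorisation.factors (factorise h (NonConstant⇒≉0 nc)))

  open CommutativeRing 𝔸 using (_≈_; 0#; semiring)
  open Divisibility semiring using (_∣_)
  open Residues 𝔸
  private module 𝔸[x] = Polynomial 𝔸

  -- Membership in 𝒜_f, the polynomials of degree less than deg f and 0.

  Reduced : Poly → Poly → Set ℓ
  Reduced f h = deg h ℕ.< deg f ⊎ h ≈ 0#

  -- A function from 𝔸_f to 𝔸_g is a Func: it acts on polynomials and
  -- maps congruent ones (mod f) to congruent ones (mod g).

  ResidueFunction : Poly → Poly → Set (c ⊔ ℓ)
  ResidueFunction f g = Func (Residue f) (Residue g)

  module _ (f g : Poly) (σ : ResidueFunction f g) where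

    open Func σ using (to)

    IsPolynomialFunction : Set (c ⊔ ℓ)
    IsPolynomialFunction =
      Σ[ G ∈ 𝔸[x].Poly ] ∀ h → Reduced f h → to h ≡ 𝔸[x].eval G h [mod g ]

    CongruencePreserving : Set (c ⊔ ℓ)
    CongruencePreserving =
      ∀ h₁ h₂ → Reduced f h₁ → Reduced f h₂ → ∀ h → h ∣ g →
      h₁ ≡ h₂ [mod h ] → to h₁ ≡ to h₂ [mod h ]

  ChenPair : Poly → Poly → Set (c ⊔ ℓ)
  ChenPair f g = ∀ (σ : ResidueFunction f g) →
    CongruencePreserving f g σ → IsPolynomialFunction f g σ

{-# OPTIONS --safe #-}

-- By the Chinese remainder theorem it suffices to treat g = P ^ e, and f
-- enters only through the set D of polynomials of degree less than deg f.
--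
-- If deg f < γ (P ^ e), Newton interpolation works on D, or on a set of
-- representatives contained in D: the product of the differences of a new
-- node with the earlier ones is a unit modulo P ^ e, or a unit times P.  In
-- the second case one earlier node is congruent to the new one modulo P, so
-- the correction to be made is divisible by P as well.
--
-- Conversely, let G be a polynomial over 𝔸.  Then x y divides the second
-- difference G(0) - G(x) - G(y) + G(x + y).  For g = P ^ e * m with P ∤ m, the
-- function with value P ^ j * m on the multiples of P ^ (j + 1) and 0 elsewhere
-- is congruence preserving, and it violates this divisibility modulo
-- P ^ (j + 1) if x y is a multiple of P ^ (j + 1) but x, y and x + y are not.
-- Suitable x and y are P and b P with b ≠ 0, -1 for q > 2; P and t P for
-- q = 2 and deg P ≥ 2; P and P ^ 2, with j = 2, for q = 2 and deg P = 1.

module Submission where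

open import Algebra.Bundles using (CommutativeRing)
import Algebra.Properties.AbelianGroup as AbelianGroupProperties
import Algebra.Properties.CommutativeSemigroup.Divisibility as SemigroupDivisibility
import Algebra.Properties.Group as GroupProperties
import Algebra.Properties.Ring as RingProperties
import Algebra.Properties.Semiring.Divisibility as Divisibility
import Algebra.Properties.Semiring.Exp as Exp
import Algebra.Properties.Semiring.Mult.TCOptimised as Mult
import Algebra.Properties.Semiring.Primality as Primality
import Algebra.Solver.Ring as RingSolver
open import Algebra.Solver.Ring.AlmostCommutativeRing
  using (fromCommutativeRing; _-Raw-AlmostCommutative⟶_; Induced-equivalence)
open import Data.Fin.Base using (Fin; zero; suc)
open import Data.Integer.Base as ℤ using (ℤ; +_; -[1+_])
import Data.Integer.Properties as ℤ
open import Data.List.Base using (List; []; _∷_; allFin; deduplicate; foldr; map)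
open import Data.List.Membership.Propositional using (_∈_; find; lose)
open import Data.List.Membership.Propositional.Properties using (∈-cartesianProductWith⁻)
open import Data.List.Relation.Unary.All as All using (All; []; _∷_)
import Data.List.Relation.Unary.All.Properties as All
open import Data.List.Relation.Unary.AllPairs using (AllPairs; []; _∷_)
open import Data.List.Relation.Unary.Any as Any using (Any; here; there)
import Data.List.Relation.Unary.Any.Properties as Any
import Data.List.Relation.Unary.Unique.DecSetoid.Properties as Unique
open import Data.Maybe.Base using (just; nothing)
open import Data.Nat.Base as ℕ using (ℕ; zero; suc; z≤n; s≤s)
import Data.Nat.Properties as ℕ
open import Data.Product.Base using (∃-syntax; _×_; _,_; proj₁; proj₂)
import Data.Sign.Base as Sign
open import Data.Sum.Base using (_⊎_; inj₁; inj₂; [_,_]′)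
open import Function.Base using (_∘_)
open import Function.Bundles using (Func; Inverse; _⇔_; mk⇔)
open import Level using (Level; _⊔_)
open import Relation.Binary.Bundles using (DecSetoid; Setoid)
open import Relation.Binary.Construct.Add.Supremum.Strict ℕ._<_ using ([_]; [_]<⊤⁺; <⁺-dec)
open import Relation.Binary.Definitions using (WeaklyDecidable)
open import Relation.Binary.PropositionalEquality as ≡ using (_≡_; _≢_)
import Relation.Binary.Reasoning.Setoid as SetoidReasoning
open import Relation.Nullary.Decidable using (Dec; yes; no; map′)
open import Relation.Nullary.Negation using (¬_; contradiction)
open import Relation.Unary using (Pred; _⊆_)
open import Defs

-- Ring solver with integer coefficients.

-- Terms cancel only if the solver can decide equality of coefficients, so
-- they are taken from ℤ and not from the ring.

module ℤ-Solver {c ℓ} (R : CommutativeRing c ℓ) where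

  open CommutativeRing R
  open AbelianGroupProperties +-abelianGroup using () renaming (⁻¹-∙-comm to -‿+-comm)
  open GroupProperties +-group using ()
    renaming (ε⁻¹≈ε to -0≈0; ⁻¹-involutive to -‿involutive)
  open RingProperties ring using (-‿distribˡ-*; -‿distribʳ-*)
  open Mult semiring using (×-homo-+; 1+×; ×1-homo-*) renaming (_×_ to _×′_)
  open SetoidReasoning setoid

  fromℤ : ℤ → Carrier
  fromℤ (+ n)    = n ×′ 1#
  fromℤ -[1+ n ] = - (suc n ×′ 1#)

  fromℤ-⊖ : ∀ m n → fromℤ (m ℤ.⊖ n) ≈ m ×′ 1# - n ×′ 1#
  fromℤ-⊖ zero    zero    = sym (-‿inverseʳ 0#)
  fromℤ-⊖ (suc m) zero    = sym (trans (+-congˡ -0≈0) (+-identityʳ _))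
  fromℤ-⊖ zero    (suc n) = sym (+-identityˡ _)
  fromℤ-⊖ (suc m) (suc n) = begin
    fromℤ (suc m ℤ.⊖ suc n)                ≡⟨ ≡.cong fromℤ (ℤ.[1+m]⊖[1+n]≡m⊖n m n) ⟩
    fromℤ (m ℤ.⊖ n)                        ≈⟨ fromℤ-⊖ m n ⟩
    m ×′ 1# - n ×′ 1#                      ≈⟨ +-congʳ (+-identityˡ _) ⟨
    0# + m ×′ 1# - n ×′ 1#                 ≈⟨ +-congʳ (+-congʳ (-‿inverseʳ 1#)) ⟨
    1# - 1# + m ×′ 1# - n ×′ 1#            ≈⟨ +-congʳ (+-assoc 1# (- 1#) _) ⟩
    1# + (- 1# + m ×′ 1#) - n ×′ 1#        ≈⟨ +-congʳ (+-congˡ (+-comm (- 1#) _)) ⟩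
    1# + (m ×′ 1# - 1#) - n ×′ 1#          ≈⟨ +-congʳ (+-assoc 1# _ (- 1#)) ⟨
    1# + m ×′ 1# - 1# - n ×′ 1#            ≈⟨ +-assoc _ (- 1#) _ ⟩
    1# + m ×′ 1# + (- 1# - n ×′ 1#)        ≈⟨ +-congˡ (-‿+-comm 1# _) ⟩
    1# + m ×′ 1# - (1# + n ×′ 1#)          ≈⟨ +-cong (1+× m 1#) (-‿cong (1+× n 1#)) ⟨
    suc m ×′ 1# - suc n ×′ 1#                ∎

  fromℤ-+ : ∀ i j → fromℤ (i ℤ.+ j) ≈ fromℤ i + fromℤ j
  fromℤ-+ (+ m)    (+ n)    = ×-homo-+ 1# m n
  fromℤ-+ (+ m)    -[1+ n ] = fromℤ-⊖ m (suc n)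
  fromℤ-+ -[1+ m ] (+ n)    = trans (fromℤ-⊖ n (suc m)) (+-comm _ _)
  fromℤ-+ -[1+ m ] -[1+ n ] = begin
    - (suc (suc (m ℕ.+ n)) ×′ 1#)          ≡⟨ ≡.cong (λ k → - (suc k ×′ 1#)) (ℕ.+-suc m n) ⟨
    - ((suc m ℕ.+ suc n) ×′ 1#)            ≈⟨ -‿cong (×-homo-+ 1# (suc m) (suc n)) ⟩
    - (suc m ×′ 1# + suc n ×′ 1#)          ≈⟨ -‿+-comm _ _ ⟨
    - (suc m ×′ 1#) - suc n ×′ 1#            ∎

  fromℤ-neg : ∀ i → fromℤ (ℤ.- i) ≈ - fromℤ i
  fromℤ-neg (+ zero)  = sym -0≈0
  fromℤ-neg (+ suc n) = refl
  fromℤ-neg -[1+ n ]  = sym (-‿involutive _)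

  fromℤ-+◃ : ∀ n → fromℤ (Sign.+ ℤ.◃ n) ≈ n ×′ 1#
  fromℤ-+◃ zero    = refl
  fromℤ-+◃ (suc n) = refl

  fromℤ--◃ : ∀ n → fromℤ (Sign.- ℤ.◃ n) ≈ - (n ×′ 1#)
  fromℤ--◃ zero    = sym -0≈0
  fromℤ--◃ (suc n) = refl

  fromℤ-* : ∀ i j → fromℤ (i ℤ.* j) ≈ fromℤ i * fromℤ j
  fromℤ-* (+ m)    (+ n)    = trans (fromℤ-+◃ (m ℕ.* n)) (×1-homo-* m n)
  fromℤ-* (+ m)    -[1+ n ] = begin
    fromℤ (+ m ℤ.* -[1+ n ])               ≈⟨ fromℤ--◃ (m ℕ.* suc n) ⟩
    - ((m ℕ.* suc n) ×′ 1#)                ≈⟨ -‿cong (×1-homo-* m (suc n)) ⟩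
    - (m ×′ 1# * (suc n ×′ 1#))            ≈⟨ -‿distribʳ-* _ _ ⟩
    m ×′ 1# * - (suc n ×′ 1#)                ∎
  fromℤ-* -[1+ m ] (+ n)    = begin
    fromℤ (-[1+ m ] ℤ.* + n)               ≈⟨ fromℤ--◃ (suc m ℕ.* n) ⟩
    - ((suc m ℕ.* n) ×′ 1#)                ≈⟨ -‿cong (×1-homo-* (suc m) n) ⟩
    - (suc m ×′ 1# * (n ×′ 1#))            ≈⟨ -‿distribˡ-* _ _ ⟩
    - (suc m ×′ 1#) * (n ×′ 1#)              ∎
  fromℤ-* -[1+ m ] -[1+ n ] = begin
    (suc m ℕ.* suc n) ×′ 1#                ≈⟨ ×1-homo-* (suc m) (suc n) ⟩
    suc m ×′ 1# * (suc n ×′ 1#)            ≈⟨ -‿involutive _ ⟨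
    - - (suc m ×′ 1# * (suc n ×′ 1#))      ≈⟨ -‿cong (-‿distribˡ-* _ _) ⟩
    - (- (suc m ×′ 1#) * (suc n ×′ 1#))    ≈⟨ -‿distribʳ-* _ _ ⟩
    - (suc m ×′ 1#) * - (suc n ×′ 1#)        ∎

  morphism : ℤ.+-*-rawRing -Raw-AlmostCommutative⟶ fromCommutativeRing R
  morphism = record
    { ⟦_⟧    = fromℤ
    ; +-homo = fromℤ-+
    ; *-homo = fromℤ-*
    ; -‿homo = fromℤ-neg
    ; 0-homo = refl
    ; 1-homo = refl
    }

  _≟′_ : WeaklyDecidable (Induced-equivalence morphism)
  i ≟′ j with i ℤ.≟ j
  ... | yes ≡.refl = just refl
  ... | no  _      = nothing

  open RingSolver ℤ.+-*-rawRing (fromCommutativeRing R) morphism _≟′_ public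
    using (solve; _:=_; _:+_; _:*_; _:-_; :-_; con)

-- Congruences, comaximality and interpolation over a commutative ring.

module Congruences {c ℓ} (R : CommutativeRing c ℓ) where

  open CommutativeRing R
  open Divisibility semiring using (_∣_; _,_; ∣ʳ-respʳ-≈; ∣ʳ-respˡ-≈; ∣ʳ-refl; x∣ʳyx; x∣ʳy⇒x∣ʳzy)
  open SemigroupDivisibility *-commutativeSemigroup using (x∣y⇒zx∣zy)
  open Exp semiring using (_^_)
  open Residues R
  open ℤ-Solver R
  open SetoidReasoning setoid
  private module R[x] = Polynomial R
  open R[x] using (eval)

  ∣-− : ∀ {h a b} → h ∣ a → h ∣ b → h ∣ a - b
  ∣-− h∣a h∣b = ∣-+ h∣a (∣-neg h∣b)

  ∣-+-cancel : ∀ {h a b} → h ∣ a + b → h ∣ b → h ∣ a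
  ∣-+-cancel {h} {a} {b} h∣a+b h∣b = ∣ʳ-respʳ-≈
    (solve 2 (λ a b → a :+ b :- b := a) refl a b) (∣-− h∣a+b h∣b)

  ≈⇒≡ : ∀ {h a b} → a ≈ b → a ≡ b [mod h ]
  ≈⇒≡ {h} {a} {b} a≈b = 0# , trans (zeroˡ h) (sym (trans (+-congʳ a≈b) (-‿inverseʳ b)))

  ≡-mod-1 : ∀ a b → a ≡ b [mod 1# ]
  ≡-mod-1 a b = a - b , *-identityʳ (a - b)

  ≡-weaken : ∀ {h k a b} → h ∣ k → a ≡ b [mod k ] → a ≡ b [mod h ]
  ≡-weaken {h} (u , uh≈k) (v , vk≈a-b) =
    v * u , trans (*-assoc v u h) (trans (*-congˡ uh≈k) vk≈a-b)

  module _ {h : Carrier} where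
    open Setoid (Residue h) public
      using () renaming (sym to ≡-sym; trans to ≡-trans)

  eval-cong : ∀ G {x y} → x ≈ y → eval G x ≈ eval G y
  eval-cong []      x≈y = refl
  eval-cong (a ∷ G) x≈y = +-congˡ (*-cong x≈y (eval-cong G x≈y))

  eval-+ : ∀ F G x → eval (F R[x].+ G) x ≈ eval F x + eval G x
  eval-+ []      G       x = sym (+-identityˡ _)
  eval-+ (a ∷ F) []      x = sym (+-identityʳ _)
  eval-+ (a ∷ F) (b ∷ G) x = trans (+-congˡ (*-congˡ (eval-+ F G x)))
    (solve 5 (λ a b x u v → a :+ b :+ x :* (u :+ v) := (a :+ x :* u) :+ (b :+ x :* v))
      refl a b x (eval F x) (eval G x))

  eval-· : ∀ a F x → eval (a R[x].· F) x ≈ a * eval F x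
  eval-· a []      x = sym (zeroʳ a)
  eval-· a (b ∷ F) x = trans (+-congˡ (*-congˡ (eval-· a F x)))
    (solve 4 (λ a b x u → a :* b :+ x :* (a :* u) := a :* (b :+ x :* u))
      refl a b x (eval F x))

  -- In Horner form the difference is x times the difference of the tails plus the tail at y times x
  -- - y.
  eval-≡ : ∀ G {h x y} → x ≡ y [mod h ] → eval G x ≡ eval G y [mod h ]
  eval-≡ []      x≡y = ≈⇒≡ refl
  eval-≡ (a ∷ G) {h} {x} {y} x≡y = ∣ʳ-respʳ-≈
    (sym (solve 5 (λ a x y u v → (a :+ x :* u) :- (a :+ y :* v) :=
                                 x :* (u :- v) :+ v :* (x :- y))
      refl a x y (eval G x) (eval G y)))
    (∣-+ (x∣ʳy⇒x∣ʳzy x (eval-≡ G x≡y)) (x∣ʳy⇒x∣ʳzy (eval G y) x≡y))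

  -- Second differences of polynomial functions.

  secondDifference : (Carrier → Carrier) → Carrier → Carrier → Carrier
  secondDifference σ x y = (σ 0# - σ x) - σ y + σ (x + y)

  secondDifference-≡ : ∀ {h} (σ τ : Carrier → Carrier) x y →
    σ 0# ≡ τ 0# [mod h ] → σ x ≡ τ x [mod h ] →
    σ y ≡ τ y [mod h ] → σ (x + y) ≡ τ (x + y) [mod h ] →
    secondDifference σ x y ≡ secondDifference τ x y [mod h ]
  secondDifference-≡ σ τ x y e₀ e₁ e₂ e₃ = ∣ʳ-respʳ-≈
    (solve 8 (λ s₀ s₁ s₂ s₃ t₀ t₁ t₂ t₃ →
        ((s₀ :- t₀) :- (s₁ :- t₁)) :- (s₂ :- t₂) :+ (s₃ :- t₃) :=
        ((s₀ :- s₁) :- s₂ :+ s₃) :- ((t₀ :- t₁) :- t₂ :+ t₃))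
      refl (σ 0#) (σ x) (σ y) (σ (x + y)) (τ 0#) (τ x) (τ y) (τ (x + y)))
    (∣-+ (∣-− (∣-− e₀ e₁) e₂) e₃)

  -- After one Horner step, with G now the tail, the second difference is x (G(x + y) - G(x)) + y
  -- (G(x + y) - G(y)). By `eval-≡` the first bracket is a multiple of y and the second a multiple
  -- of x.
  *∣secondDifference : ∀ G x y → x * y ∣ secondDifference (eval G) x y
  *∣secondDifference []      x y = 0# , trans (zeroˡ _)
    (solve 0 (con (+ 0) := (con (+ 0) :- con (+ 0)) :- con (+ 0) :+ con (+ 0)) refl)
  *∣secondDifference (a ∷ G) x y = ∣ʳ-respʳ-≈
    (solve 7 (λ a x y t u v w →
        x :* (w :- u) :+ y :* (w :- v) :=
        ((a :+ con (+ 0) :* t) :- (a :+ x :* u)) :- (a :+ y :* v) :+ (a :+ (x :+ y) :* w))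
      refl a x y (eval G 0#) (eval G x) (eval G y) (eval G (x + y)))
    (∣-+ (x∣y⇒zx∣zy x (eval-≡ G
            (∣ʳ-respʳ-≈ (sym (solve 2 (λ x y → (x :+ y) :- x := y) refl x y)) ∣ʳ-refl)))
         (∣ʳ-respˡ-≈ (*-comm y x) (x∣y⇒zx∣zy y (eval-≡ G
            (∣ʳ-respʳ-≈ (sym (solve 2 (λ x y → (x :+ y) :- y := x) refl x y)) ∣ʳ-refl)))))

  -- Comaximal elements and the Chinese remainder theorem.

  Comaximal : Carrier → Carrier → Set (c ⊔ ℓ)
  Comaximal a b = ∃[ u ] ∃[ v ] u * a + v * b ≈ 1#

  comaximal-sym : ∀ {a b} → Comaximal a b → Comaximal b a
  comaximal-sym (u , v , e) = v , u , trans (+-comm _ _) e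

  comaximal-respˡ : ∀ {a a′ b} → a ≈ a′ → Comaximal a b → Comaximal a′ b
  comaximal-respˡ a≈a′ (u , v , e) = u , v , trans (+-congʳ (*-congˡ (sym a≈a′))) e

  comaximal-∣1 : ∀ {a} b → a ∣ 1# → Comaximal a b
  comaximal-∣1 b (u , ua≈1) = u , 0# , trans (+-cong ua≈1 (zeroˡ b)) (+-identityʳ 1#)

  -- Multiply the two Bézout identities: every term other than u u′ a b is a multiple of d.
  comaximal-* : ∀ {a b d} → Comaximal a d → Comaximal b d → Comaximal (a * b) d
  comaximal-* {a} {b} {d} (u , v , e) (u′ , v′ , e′) =
    u * u′ , u * a * v′ + v * (u′ * b + v′ * d) , (begin
      (u * u′) * (a * b) + (u * a * v′ + v * (u′ * b + v′ * d)) * d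
        ≈⟨ solve 7 (λ u a v b u′ v′ d →
             (u :* u′) :* (a :* b) :+ (u :* a :* v′ :+ v :* (u′ :* b :+ v′ :* d)) :* d :=
             (u :* a :+ v :* d) :* (u′ :* b :+ v′ :* d)) refl u a v b u′ v′ d ⟩
      (u * a + v * d) * (u′ * b + v′ * d)
        ≈⟨ *-cong e e′ ⟩
      1# * 1#
        ≈⟨ *-identityˡ 1# ⟩
      1#
        ∎)

  comaximal-^ : ∀ {a d} k → Comaximal a d → Comaximal (a ^ k) d
  comaximal-^ zero    a⊥d = comaximal-∣1 _ ∣ʳ-refl
  comaximal-^ (suc k) a⊥d = comaximal-* a⊥d (comaximal-^ k a⊥d)

  -- Multiplying u a + v b = 1 by x writes x as a combination of a and b x.
  comaximal⇒∣ : ∀ {a b x} → Comaximal a b → a ∣ b * x → a ∣ x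
  comaximal⇒∣ {a} {b} {x} (u , v , e) a∣bx = ∣ʳ-respʳ-≈ (begin
    (u * x) * a + v * (b * x)
      ≈⟨ solve 5 (λ u a v b x → (u :* x) :* a :+ v :* (b :* x) :=
                                (u :* a :+ v :* b) :* x) refl u a v b x ⟩
    (u * a + v * b) * x
      ≈⟨ *-congʳ e ⟩
    1# * x
      ≈⟨ *-identityˡ x ⟩
    x
      ∎) (∣-+ (x∣ʳyx a (u * x)) (x∣ʳy⇒x∣ʳzy v a∣bx))

  -- The coefficient v b is 1 modulo a and 0 modulo b, and u a the reverse. H is chosen before the
  -- point x, so it serves at all points of a domain at once.
  chineseRemainder : ∀ {a b} → Comaximal a b → (F G : R[x].Poly) →
    ∃[ H ] ∀ x s → eval F x ≡ s [mod a ] → eval G x ≡ s [mod b ] → eval H x ≡ s [mod a * b ]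
  chineseRemainder {a} {b} (u , v , e) F G = H , correct
    where
    H = (v * b) R[x].· F R[x].+ (u * a) R[x].· G
    correct : ∀ x s → eval F x ≡ s [mod a ] → eval G x ≡ s [mod b ] → eval H x ≡ s [mod a * b ]
    correct x s F≡s G≡s = ∣ʳ-respʳ-≈ (begin
      v * (b * (eval F x - s)) + u * (a * (eval G x - s))
        ≈⟨ solve 7 (λ u a v b x y s →
             v :* (b :* (x :- s)) :+ u :* (a :* (y :- s)) :=
             ((v :* b) :* x :+ (u :* a) :* y) :- (u :* a :+ v :* b) :* s)
             refl u a v b (eval F x) (eval G x) s ⟩
      ((v * b) * eval F x + (u * a) * eval G x) - (u * a + v * b) * s
        ≈⟨ +-cong (+-cong (eval-· (v * b) F x) (eval-· (u * a) G x))
                  (-‿cong (trans (sym (*-identityˡ s)) (*-congʳ (sym e)))) ⟨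
      (eval ((v * b) R[x].· F) x + eval ((u * a) R[x].· G) x) - s
        ≈⟨ +-congʳ (eval-+ ((v * b) R[x].· F) ((u * a) R[x].· G) x) ⟨
      eval H x - s
        ∎)
      (∣-+ (x∣ʳy⇒x∣ʳzy v (∣ʳ-respˡ-≈ (*-comm b a) (x∣y⇒zx∣zy b F≡s)))
           (x∣ʳy⇒x∣ʳzy u (x∣y⇒zx∣zy a G≡s)))

  -- Nodal polynomials and the Newton step.

  nodal : List Carrier → R[x].Poly
  nodal []       = R[x].1#
  -- Prepending `0#` multiplies by the variable X, so this is X - y times `nodal ys`.
  nodal (y ∷ ys) = (0# ∷ nodal ys) R[x].+ (- y) R[x].· nodal ys

  eval-nodal-[] : ∀ x → eval (nodal []) x ≈ 1#
  eval-nodal-[] x = trans (+-congˡ (zeroʳ x)) (+-identityʳ 1#)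

  eval-nodal-∷ : ∀ y ys x → eval (nodal (y ∷ ys)) x ≈ (x - y) * eval (nodal ys) x
  eval-nodal-∷ y ys x = begin
    eval (nodal (y ∷ ys)) x
      ≈⟨ eval-+ (0# ∷ nodal ys) ((- y) R[x].· nodal ys) x ⟩
    (0# + x * N) + eval ((- y) R[x].· nodal ys) x
      ≈⟨ +-congˡ (eval-· (- y) (nodal ys) x) ⟩
    (0# + x * N) + - y * N
      ≈⟨ solve 3 (λ x y N → (con (+ 0) :+ x :* N) :+ :- y :* N := (x :- y) :* N) refl x y N ⟩
    (x - y) * N
      ∎
    where N = eval (nodal ys) x

  nodal-root : ∀ {x ys} → Any (x ≈_) ys → eval (nodal ys) x ≈ 0#
  nodal-root {x} {y ∷ ys} (here x≈y) = trans (eval-nodal-∷ y ys x)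
    (trans (*-congʳ (trans (+-congʳ x≈y) (-‿inverseʳ y))) (zeroˡ _))
  nodal-root {x} {y ∷ ys} (there x∈) = trans (eval-nodal-∷ y ys x)
    (trans (*-congˡ (nodal-root x∈)) (zeroʳ _))

  -- The value of the nodal polynomial at the new node need not be invertible,
  -- provided that its non-invertible part p divides the correction to be made.
  newtonStep : ∀ {M p w} F ys x s → eval (nodal ys) x ≈ w * p → Comaximal w M →
    eval F x ≡ s [mod p ] →
    ∃[ G ] eval G x ≡ s [mod M ] × (∀ y → Any (y ≈_) ys → eval G y ≈ eval F y)
  newtonStep {M} {p} {w} F ys x s N≈wp (u , v , e) (z , zp≈) = G , new , old
    where
    -- The error of F at x is z p, and u inverts w modulo M, so adding k w p cancels the error up to
    -- a multiple of M.
    k = - (z * u)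
    G = F R[x].+ k R[x].· nodal ys
    eval-G : ∀ y → eval G y ≈ eval F y + k * eval (nodal ys) y
    eval-G y = trans (eval-+ F (k R[x].· nodal ys) y) (+-congˡ (eval-· k (nodal ys) y))
    old : ∀ y → Any (y ≈_) ys → eval G y ≈ eval F y
    old y y∈ = trans (eval-G y)
      (trans (+-congˡ (trans (*-congˡ (nodal-root y∈)) (zeroʳ k))) (+-identityʳ _))
    new : eval G x ≡ s [mod M ]
    new = z * v * p , (begin
      z * v * p * M
        ≈⟨ solve 6 (λ z v p M u w → z :* v :* p :* M :=
             (u :* w :+ v :* M) :* (z :* p) :+ :- (z :* u) :* (w :* p)) refl z v p M u w ⟩
      (u * w + v * M) * (z * p) + k * (w * p)
        ≈⟨ +-cong (trans (*-congʳ e) (*-identityˡ _)) (*-congˡ (sym N≈wp)) ⟩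
      z * p + k * eval (nodal ys) x
        ≈⟨ +-congʳ zp≈ ⟩
      eval F x - s + k * eval (nodal ys) x
        ≈⟨ solve 3 (λ f s t → f :- s :+ t := f :+ t :- s) refl (eval F x) s _ ⟩
      eval F x + k * eval (nodal ys) x - s
        ≈⟨ +-congʳ (eval-G x) ⟨
      eval G x - s
        ∎)

-- Interpolation of congruence preserving functions on a set of points.

module ChenTheory {c ℓ} (R : CommutativeRing c ℓ) where

  open CommutativeRing R
  open Divisibility semiring using
    (_∣_; _∤_; _,_; ∣ʳ-respʳ-≈; ∣ʳ-respˡ-≈; ∣ʳ-refl; ∣ʳ-trans; x∣ʳyx; x∣ʳy⇒x∣ʳzy; _∣0)
  open SemigroupDivisibility *-commutativeSemigroup using (x∣xy; x∣y⇒zx∣zy)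
  open Exp semiring using (_^_; ^-homo-*)
  open Residues R
  open Congruences R
  open ℤ-Solver R
  open SetoidReasoning setoid
  private module R[x] = Polynomial R
  open R[x] using (eval)

  Preserves : Pred Carrier ℓ → Carrier → (Carrier → Carrier) → Set (c ⊔ ℓ)
  Preserves D g σ = ∀ x y → D x → D y → ∀ h → h ∣ g → x ≡ y [mod h ] → σ x ≡ σ y [mod h ]

  Interpolates : Pred Carrier ℓ → Carrier → (Carrier → Carrier) → Set (c ⊔ ℓ)
  Interpolates D g σ = ∃[ G ] ∀ x → D x → eval G x ≡ σ x [mod g ]

  -- `ChenPair` with f replaced by a set D of points, which may then be shrunk to representatives
  -- modulo g.
  Chen : Pred Carrier ℓ → Carrier → Set (c ⊔ ℓ)
  Chen D g = ∀ σ → Preserves D g σ → Interpolates D g σ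

  preserves-∣ : ∀ {D g h} σ → h ∣ g → Preserves D g σ → Preserves D h σ
  preserves-∣ σ h∣g pr x y Dx Dy k k∣h = pr x y Dx Dy k (∣ʳ-trans k∣h h∣g)

  chen-resp : ∀ {D g h} → g ∣ h → h ∣ g → Chen D g → Chen D h
  chen-resp g∣h h∣g chen σ pr with chen σ (preserves-∣ σ g∣h pr)
  ... | G , G≡σ = G , λ x Dx → ≡-weaken h∣g (G≡σ x Dx)

  chen-1 : ∀ D → Chen D 1#
  chen-1 D σ pr = R[x].0# , λ x Dx → ≡-mod-1 _ (σ x)

  chen-* : ∀ {D a b} → Comaximal a b → Chen D a → Chen D b → Chen D (a * b)
  chen-* {a = a} {b} a⊥b chen-a chen-b σ pr =
    let (G , G≡σ) = chen-a σ (preserves-∣ σ (x∣xy a b) pr)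
        (H , H≡σ) = chen-b σ (preserves-∣ σ (x∣ʳyx b a) pr)
        (K , K≡)  = chineseRemainder a⊥b G H
    in K , λ x Dx → K≡ x (σ x) (G≡σ x Dx) (H≡σ x Dx)

  -- Modulo g the values of G depend only on the class of the point, and on D so do those of σ, by
  -- preservation for h = g.
  chen-representatives : ∀ {D E : Pred Carrier ℓ} {g} → E ⊆ D →
    (∀ x → ∃[ r ] x ≡ r [mod g ] × E r) → Chen E g → Chen D g
  chen-representatives {g = g} E⊆D represent chen σ pr
    with chen σ (λ x y Ex Ey → pr x y (E⊆D Ex) (E⊆D Ey))
  ... | G , G≡σ = G , λ x Dx → let (r , x≡r , Er) = represent x in
    ≡-trans (eval-≡ G x≡r) (≡-trans (G≡σ r Er) (pr r x (E⊆D Er) Dx g ∣ʳ-refl (≡-sym x≡r)))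

  spike : ∀ {a} {A : Set a} → Dec A → Carrier → Carrier
  spike (yes _) v = v
  spike (no  _) v = 0#

  spike-cong : ∀ {a b} {A : Set a} {B : Set b} → (A → B) → (B → A) →
    (A? : Dec A) (B? : Dec B) → ∀ v → spike A? v ≈ spike B? v
  spike-cong f g (yes a) (yes b) v = refl
  spike-cong f g (yes a) (no ¬b) v = contradiction (f a) ¬b
  spike-cong f g (no ¬a) (yes b) v = contradiction (g b) ¬a
  spike-cong f g (no ¬a) (no ¬b) v = refl

  spike-yes : ∀ {a} {A : Set a} → A → (A? : Dec A) → ∀ v → spike A? v ≈ v
  spike-yes a (yes _) v = refl
  spike-yes a (no ¬a) v = contradiction a ¬a

  spike-no : ∀ {a} {A : Set a} → ¬ A → (A? : Dec A) → ∀ v → spike A? v ≈ 0#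
  spike-no ¬a (yes a) v = contradiction a ¬a
  spike-no ¬a (no _)  v = refl

  ∣-spike : ∀ {a} {A : Set a} (A? : Dec A) → ∀ v → v ∣ spike A? v
  ∣-spike (yes _) v = ∣ʳ-refl
  ∣-spike (no  _) v = v ∣0

  -- Newton interpolation modulo a prime power.

  module AtPrime (p : Carrier) (p∣? : ∀ a → Dec (p ∣ a))
                 (∤⇒comaximal : ∀ {a} → p ∤ a → Comaximal a p) where

    -- At a point of D the nodal polynomial of other points of D is then divisible
    -- by p at most once.
    record Sparse (D : Pred Carrier ℓ) : Set (c ⊔ ℓ) where
      field
        pairs   : ∀ x y → D x → D y → x ≉ y → p * p ∤ x - y
        triples : ∀ x y z → D x → D y → D z → x ≉ y → x ≉ z → y ≉ z → p ∣ x - y → p ∤ x - z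

    nodal-comaximal : ∀ x {ys} → All (λ y → p ∤ x - y) ys → Comaximal (eval (nodal ys) x) p
    nodal-comaximal x {[]}     []        =
      comaximal-respˡ (sym (eval-nodal-[] x)) (comaximal-∣1 p ∣ʳ-refl)
    nodal-comaximal x {y ∷ ys} (p∤ ∷ ps) = comaximal-respˡ (sym (eval-nodal-∷ y ys x))
      (comaximal-* (∤⇒comaximal p∤) (nodal-comaximal x ps))

    -- By `triples` at most one node is congruent to x modulo p, and by `pairs` its difference from
    -- x contains p only once. All other differences are comaximal with p.
    nodal-value : ∀ {D} → Sparse D → ∀ x {ys} → D x → All D ys →
      AllPairs _≉_ ys → All (x ≉_) ys →
      Comaximal (eval (nodal ys) x) p ⊎
      Any (λ y → x ≡ y [mod p ]) ys × ∃[ w ] eval (nodal ys) x ≈ w * p × Comaximal w p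
    nodal-value S x {[]} Dx [] [] [] = inj₁ (nodal-comaximal x [])
    nodal-value S x {y ∷ ys} Dx (Dy ∷ Dys) (y≉ ∷ dys) (x≉y ∷ x≉) with p∣? (x - y)
    ... | yes (a , ap≈x-y) = inj₂ (here (a , ap≈x-y) , a * N , (begin
            eval (nodal (y ∷ ys)) x    ≈⟨ eval-nodal-∷ y ys x ⟩
            (x - y) * N                ≈⟨ *-congʳ ap≈x-y ⟨
            a * p * N                  ≈⟨ solve 3 (λ a p N → a :* p :* N := a :* N :* p)
                                            refl a p N ⟩
            a * N * p                  ∎) , comaximal-* a⊥p (nodal-comaximal x rest))
      where
      N = eval (nodal ys) x
      -- A factor p of a would be a second factor p of x - y.
      a⊥p : Comaximal a p
      a⊥p = ∤⇒comaximal λ (b , bp≈a) → Sparse.pairs S x y Dx Dy x≉y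
        (b , trans (sym (*-assoc b p p)) (trans (*-congʳ bp≈a) ap≈x-y))
      rest : All (λ z → p ∤ x - z) ys
      rest = All.tabulate λ {z} z∈ → Sparse.triples S x y z Dx Dy (All.lookup Dys z∈)
        x≉y (All.lookup x≉ z∈) (All.lookup y≉ z∈) (a , ap≈x-y)
    ... | no  p∤x-y with nodal-value S x Dx Dys dys x≉ | ∤⇒comaximal p∤x-y
    ... | inj₁ N⊥p                   | x-y⊥p =
      inj₁ (comaximal-respˡ (sym (eval-nodal-∷ y ys x)) (comaximal-* x-y⊥p N⊥p))
    ... | inj₂ (near , w , N≈ , w⊥p) | x-y⊥p =
      inj₂ (there near , (x - y) * w
           , trans (eval-nodal-∷ y ys x) (trans (*-congˡ N≈) (sym (*-assoc (x - y) w p)))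
           , comaximal-* x-y⊥p w⊥p)

    -- Nodes are added one at a time. Preservation modulo p is what σ has to satisfy, because the
    -- nodal value at a new node contains p at most once.
    interpolate : ∀ {D} e (σ : Carrier → Carrier) → Sparse D →
      (∀ x y → D x → D y → x ≡ y [mod p ] → σ x ≡ σ y [mod p ]) →
      ∀ ys → All D ys → AllPairs _≉_ ys →
      ∃[ G ] All (λ y → eval G y ≡ σ y [mod p ^ suc e ]) ys
    interpolate         e σ S pr []       []         []         = R[x].0# , []
    interpolate {D = D} e σ S pr (x ∷ ys) (Dx ∷ Dys) (x≉ ∷ dys)
      with interpolate e σ S pr ys Dys dys
    ... | G , G≡σ = extend (nodal-value S x Dx Dys dys x≉)
      where
      M = p ^ suc e
      ⊥p⇒⊥M : ∀ {w} → Comaximal w p → Comaximal w M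
      ⊥p⇒⊥M = comaximal-sym ∘ comaximal-^ (suc e) ∘ comaximal-sym
      conclude : ∃[ H ] eval H x ≡ σ x [mod M ] × (∀ y → Any (y ≈_) ys → eval H y ≈ eval G y) →
                 ∃[ H ] All (λ y → eval H y ≡ σ y [mod M ]) (x ∷ ys)
      conclude (H , new , old) = H , new ∷ All.tabulate λ {y} y∈ →
        ≡-trans (≈⇒≡ (old y (Any.map reflexive y∈))) (All.lookup G≡σ y∈)
      -- For a node y congruent to x modulo p, the chain G(x), G(y), σ(y), σ(x) is congruent modulo
      -- p.
      congruent : ∀ {zs} → All D zs → All (λ y → eval G y ≡ σ y [mod M ]) zs →
                  Any (λ y → x ≡ y [mod p ]) zs → eval G x ≡ σ x [mod p ]
      congruent {y ∷ _} (Dy ∷ _)  (e ∷ _)  (here x≡y)   = ≡-trans (eval-≡ G x≡y)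
        (≡-trans (≡-weaken (x∣xy p _) e) (≡-sym (pr x y Dx Dy x≡y)))
      congruent         (_ ∷ Dzs) (_ ∷ es) (there near) = congruent Dzs es near
      extend : _ → ∃[ H ] All (λ y → eval H y ≡ σ y [mod M ]) (x ∷ ys)
      -- The nodal value is itself comaximal with M, so its non-invertible part is taken to be 1.
      extend (inj₁ N⊥p) = conclude (newtonStep G ys x (σ x)
        (sym (*-identityʳ _)) (⊥p⇒⊥M N⊥p) (≡-mod-1 _ _))
      extend (inj₂ (near , w , N≈wp , w⊥p)) =
        conclude (newtonStep G ys x (σ x) N≈wp (⊥p⇒⊥M w⊥p) (congruent Dys G≡σ near))

    chen-sparse : ∀ {D} e → Sparse D → ∀ nodes → All D nodes → AllPairs _≉_ nodes →
                  (∀ x → D x → Any (x ≈_) nodes) → Chen D (p ^ suc e)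
    chen-sparse {D} e S nodes Dnodes distinct complete σ pr =
      let (G , G≡σ) = interpolate e σ S
            (λ x y Dx Dy → pr x y Dx Dy p (x∣xy p (p ^ e))) nodes Dnodes distinct
      in G , λ x Dx →
        let (y , y∈ , x≈y) = find (complete x Dx) in
        ≡-trans (≈⇒≡ (eval-cong G x≈y)) (≡-trans (All.lookup G≡σ y∈)
          (pr y x (All.lookup Dnodes y∈) Dx (p ^ suc e) ∣ʳ-refl (≈⇒≡ (sym x≈y))))

    -- Divisibility by powers of p, and the obstruction to interpolation.

    module _ (p∤1 : p ∤ 1#) (p-cancel : ∀ a b → p * a ≈ p * b → a ≈ b) where

      *-cancel-∣ : ∀ {a b} → p * a ∣ p * b → a ∣ b
      *-cancel-∣ {a} {b} (u , upa≈pb) = u , p-cancel (u * a) b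
        (trans (solve 3 (λ p u a → p :* (u :* a) := u :* (p :* a)) refl p u a) upa≈pb)

      ^-cancel-∣ : ∀ k {a b} → p ^ k * a ∣ p ^ k * b → a ∣ b
      ^-cancel-∣ zero    {a} {b} d = ∣ʳ-respˡ-≈ (*-identityˡ a) (∣ʳ-respʳ-≈ (*-identityˡ b) d)
      ^-cancel-∣ (suc k) {a} {b} d = ^-cancel-∣ k
        (*-cancel-∣ (∣ʳ-respˡ-≈ (*-assoc p (p ^ k) a) (∣ʳ-respʳ-≈ (*-assoc p (p ^ k) b) d)))

      comaximal⇒∤ : ∀ {a} → Comaximal a p → p ∤ a
      comaximal⇒∤ {a} a⊥p p∣a = p∤1
        (comaximal⇒∣ (comaximal-sym a⊥p) (∣ʳ-respʳ-≈ (sym (*-identityʳ a)) p∣a))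

      ^∣? : ∀ k a → Dec (p ^ k ∣ a)
      ^∣? zero    a = yes (a , *-identityʳ a)
      ^∣? (suc k) a with p∣? a
      ... | no  p∤a       = no λ d → p∤a (∣ʳ-trans (x∣xy p (p ^ k)) d)
      ... | yes (b , bp≈a) = map′
        (λ d → ∣ʳ-respʳ-≈ (trans (*-comm p b) bp≈a) (x∣y⇒zx∣zy p d))
        (λ d → *-cancel-∣ (∣ʳ-respʳ-≈ (trans (sym bp≈a) (*-comm b p)) d)) (^∣? k b)

      -- The recursion cancels one factor p at a time from h and from both powers. Once p does not
      -- divide h, h is comaximal with the remaining power of p and so divides m; if `p ^ e` is used
      -- up first, h divides m directly.
      ∣-lower : ∀ k e {h m} → h ∣ p ^ e * m → p ^ suc k ∤ h → h ∣ p ^ k * m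
      ∣-lower k e {h} {m} h∣ ∤h with p∣? h
      ... | no  p∤h = x∣ʳy⇒x∣ʳzy (p ^ k)
        (comaximal⇒∣ (comaximal-sym (comaximal-^ e (comaximal-sym (∤⇒comaximal p∤h)))) h∣)
      ∣-lower zero    e           h∣ ∤h | yes p∣h = contradiction
        (∣ʳ-respˡ-≈ (sym (*-identityʳ p)) p∣h) ∤h
      ∣-lower (suc k) zero        h∣ ∤h | yes p∣h =
        x∣ʳy⇒x∣ʳzy (p ^ suc k) (∣ʳ-respʳ-≈ (*-identityˡ _) h∣)
      ∣-lower (suc k) (suc e) {h} {m} h∣ ∤h | yes (h′ , h′p≈h) =
        ∣ʳ-respˡ-≈ ph′≈h (∣ʳ-respʳ-≈ (sym (*-assoc p (p ^ k) m)) (x∣y⇒zx∣zy p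
          (∣-lower k e
            (*-cancel-∣ (∣ʳ-respˡ-≈ (sym ph′≈h) (∣ʳ-respʳ-≈ (*-assoc p (p ^ e) m) h∣)))
            (λ d → ∤h (∣ʳ-respʳ-≈ ph′≈h (x∣y⇒zx∣zy p d))))))
        where
        ph′≈h : p * h′ ≈ h
        ph′≈h = trans (*-comm p h′) h′p≈h

      -- `rem` stands for reduction modulo f, which makes σ a function on residue classes; on
      -- representatives it is the identity.
      module Obstruction (m : Carrier) (m⊥p : Comaximal m p) (e j : ℕ) (j<e : j ℕ.< e)
                         (rem : Carrier → Carrier) where

        d v : Carrier
        d = p ^ suc j
        v = p ^ j * m

        σ : Carrier → Carrier
        σ x = spike (^∣? (suc j) (rem x)) v

        σ-cong : ∀ x y → rem x ≈ rem y → σ x ≈ σ y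
        σ-cong x y x≈y = spike-cong (∣ʳ-respʳ-≈ x≈y) (∣ʳ-respʳ-≈ (sym x≈y))
          (^∣? (suc j) (rem x)) (^∣? (suc j) (rem y)) v

        d∣g : d ∣ p ^ e * m
        d∣g with ℕ.m≤n⇒∃[o]m+o≡n j<e
        ... | k , ≡.refl = ∣ʳ-trans (∣ʳ-respʳ-≈ (sym (^-homo-* p (suc j) k)) (x∣xy d (p ^ k)))
                             (x∣xy (p ^ (suc j ℕ.+ k)) m)

        module _ {D : Pred Carrier ℓ} (rem-id : ∀ x → D x → rem x ≈ x) where

          -- If d does not divide h, then h divides v and hence every value of σ. If d divides h,
          -- then of two points congruent modulo h both or neither are multiples of d, so σ takes
          -- the same value at them.
          σ-preserves : Preserves D (p ^ e * m) σ
          σ-preserves x y Dx Dy h h∣g x≡y with ^∣? (suc j) h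
          ... | no  d∤h = ∣-− (∣ʳ-trans h∣v (∣-spike (^∣? (suc j) (rem x)) v))
                              (∣ʳ-trans h∣v (∣-spike (^∣? (suc j) (rem y)) v))
            where
            h∣v : h ∣ v
            h∣v = ∣-lower j e h∣g d∤h
          ... | yes d∣h = ≈⇒≡ (spike-cong
              (λ d∣x → ∣ʳ-respʳ-≈ (sym (rem-id y Dy))
                (transfer (≡-sym x≡y) (∣ʳ-respʳ-≈ (rem-id x Dx) d∣x)))
              (λ d∣y → ∣ʳ-respʳ-≈ (sym (rem-id x Dx))
                (transfer x≡y (∣ʳ-respʳ-≈ (rem-id y Dy) d∣y)))
              (^∣? (suc j) (rem x)) (^∣? (suc j) (rem y)) v)
            where
            transfer : ∀ {a b} → a ≡ b [mod h ] → d ∣ b → d ∣ a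
            transfer {a} {b} a≡b d∣b = ∣ʳ-respʳ-≈
              (solve 2 (λ a b → a :- b :+ b := a) refl a b) (∣-+ (∣ʳ-trans d∣h a≡b) d∣b)

          -- The second difference of σ at x and y is v. If G interpolated σ, it would agree modulo
          -- d with that of G, a multiple of x y and so of d. But d dividing v forces p to divide m.
          σ-¬interpolates : ∀ {x y} → D 0# → D x → D y → D (x + y) → d ∣ x * y →
            d ∤ x → d ∤ y → d ∤ x + y → ¬ Interpolates D (p ^ e * m) σ
          σ-¬interpolates {x} {y} D0 Dx Dy Dx+y d∣xy d∤x d∤y d∤x+y (G , G≡σ) =
            comaximal⇒∤ m⊥p (∣ʳ-respˡ-≈ (*-identityʳ p) (^-cancel-∣ j
              (∣ʳ-respˡ-≈ (solve 2 (λ p P → p :* P := P :* (p :* con (+ 1))) refl p (p ^ j)) d∣v)))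
            where
            at : ∀ z → D z → σ z ≡ eval G z [mod d ]
            at z Dz = ≡-sym (≡-weaken d∣g (G≡σ z Dz))
            σ≈0 : ∀ z → D z → d ∤ z → σ z ≈ 0#
            σ≈0 z Dz d∤z = spike-no (d∤z ∘ ∣ʳ-respʳ-≈ (rem-id z Dz)) (^∣? (suc j) (rem z)) v
            σ0≈v : σ 0# ≈ v
            σ0≈v = spike-yes (∣ʳ-respʳ-≈ (sym (rem-id 0# D0)) (d ∣0)) (^∣? (suc j) (rem 0#)) v
            d∣v : d ∣ v
            d∣v = ∣ʳ-respʳ-≈ (begin
              secondDifference σ x y - Δ + Δ
                ≈⟨ solve 2 (λ s t → s :- t :+ t := s) refl (secondDifference σ x y) Δ ⟩
              secondDifference σ x y
                ≈⟨ +-cong (+-cong (+-cong σ0≈v (-‿cong (σ≈0 x Dx d∤x))) (-‿cong (σ≈0 y Dy d∤y)))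
                          (σ≈0 (x + y) Dx+y d∤x+y) ⟩
              v - 0# - 0# + 0#
                ≈⟨ solve 1 (λ v → v :- con (+ 0) :- con (+ 0) :+ con (+ 0) := v) refl v ⟩
              v
                ∎)
              (∣-+ (secondDifference-≡ σ (eval G) x y (at 0# D0) (at x Dx) (at y Dy) (at (x + y) Dx+y))
                   (∣ʳ-trans d∣xy (*∣secondDifference G x y)))
              where Δ = secondDifference (eval G) x y

-- Degrees, division and residues over a finite field.

module Arithmetic {c ℓ q} (𝔽 : FiniteField c ℓ q) where

  private
    module F = FiniteField 𝔽
    module P = Polynomial F.commutativeRing

  open 𝔽[t] 𝔽
  open CommutativeRing 𝔸
  open P using (VanishesFrom; at; ∷-cong)
  open Congruences 𝔸
  open Divisibility semiring using (_∣_; _∤_; _,_; ∣ʳ-respʳ-≈; ∣ʳ-trans; x∣ʳyx)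
  open GroupProperties +-group using () renaming (x∙y⁻¹≈ε⇒x≈y to x-y≈0⇒x≈y)
  open Primality semiring using (Irreducible)
  open Residues 𝔸
  open ℤ-Solver 𝔸
  open ChenTheory 𝔸 using (Chen; Interpolates; Preserves; chen-representatives)
  open Exp semiring using (_^_)
  private module 𝔸[x] = Polynomial 𝔸
  open 𝔸[x] using (eval)

  vanishes-≤ : ∀ {m n} p → m ℕ.≤ n → VanishesFrom m p → VanishesFrom n p
  vanishes-≤ p m≤n v k n≤k = v k (ℕ.≤-trans m≤n n≤k)

  vanishes-resp : ∀ {n} p r → p ≈ r → VanishesFrom n p → VanishesFrom n r
  vanishes-resp p r p≈r v k n≤k = F.trans (F.sym (at p≈r k)) (v k n≤k)

  vanishes-+ : ∀ {n} p r → VanishesFrom n p → VanishesFrom n r → VanishesFrom n (p + r)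
  vanishes-+ p r v w k n≤k = F.trans (P.coeff-+ p r k)
    (F.trans (F.+-cong (v k n≤k) (w k n≤k)) (F.+-identityˡ _))

  vanishes-− : ∀ {n} p r → VanishesFrom n p → VanishesFrom n r → VanishesFrom n (p - r)
  vanishes-− p r v w = vanishes-+ p (- r) v λ k n≤k →
    F.trans (P.coeff-neg r k) (F.trans (F.-‿cong (w k n≤k)) (GroupProperties.ε⁻¹≈ε F.+-group))

  deg<⇒vanishes : ∀ {n} p → deg p ℕ.< n → VanishesFrom n p
  deg<⇒vanishes p d<n = vanishes-≤ p d<n (deg-vanishes p)

  vanishes⇒deg< : ∀ {n} p → p ≉ 0# → VanishesFrom n p → deg p ℕ.< n
  vanishes⇒deg< {n} p p≉0 v with deg p ℕ.<? n
  ... | yes d<n = d<n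
  ... | no  d≮n = contradiction (v (deg p) (ℕ.≮⇒≥ d≮n)) (leading≉0 p p≉0)

  -- `VanishesFrom` merges the two cases of `Reduced`, the zero polynomial included, into one
  -- condition closed under sums and differences.
  reduced⇒vanishes : ∀ f h → Reduced 𝔽 f h → VanishesFrom (deg f) h
  reduced⇒vanishes f h (inj₁ d<n) = deg<⇒vanishes h d<n
  reduced⇒vanishes f h (inj₂ h≈0) = vanishes-resp 0# h (sym h≈0) (λ _ _ → F.refl)

  vanishes⇒reduced : ∀ f h → VanishesFrom (deg f) h → Reduced 𝔽 f h
  vanishes⇒reduced f h v with h ≟0
  ... | yes h≈0 = inj₂ h≈0
  ... | no  h≉0 = inj₁ (vanishes⇒deg< h h≉0 v)

  ∣⇒deg≤ : ∀ a b → b ≉ 0# → a ∣ b → deg a ℕ.≤ deg b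
  ∣⇒deg≤ a b b≉0 (u , ua≈b) = ≡.subst (deg a ℕ.≤_)
    (≡.trans (≡.sym (deg-* u a u≉0 a≉0)) (deg-cong ua≈b)) (ℕ.m≤n+m (deg a) (deg u))
    where
    u≉0 : u ≉ 0#
    u≉0 u≈0 = b≉0 (trans (sym ua≈b) (trans (*-congʳ u≈0) (zeroˡ a)))
    a≉0 : a ≉ 0#
    a≉0 a≈0 = b≉0 (trans (sym ua≈b) (trans (*-congˡ {u} a≈0) (zeroʳ u)))

  ∣∧vanishes⇒≈0 : ∀ {a} b → a ∣ b → VanishesFrom (deg a) b → b ≈ 0#
  ∣∧vanishes⇒≈0 {a} b a∣b v with b ≟0
  ... | yes b≈0 = b≈0
  ... | no  b≉0 = contradiction (∣⇒deg≤ a b b≉0 a∣b) (ℕ.<⇒≱ (vanishes⇒deg< b b≉0 v))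

  NonConstant⇒∤const : ∀ {p a} → NonConstant p → a F.≉ F.0# → p ∤ const a
  NonConstant⇒∤const nc a≉0 p∣a = NonConstant⇒∤1 nc (∣ʳ-trans p∣a (const∣1 a≉0))

  *-cancelˡ : ∀ a b d → a ≉ 0# → a * b ≈ a * d → b ≈ d
  *-cancelˡ a b d a≉0 ab≈ad with (b - d) ≟0
  ... | yes b-d≈0 = x-y≈0⇒x≈y b d b-d≈0
  ... | no  b-d≉0 = contradiction (trans
    (solve 3 (λ a b d → a :* (b :- d) := a :* b :- a :* d) refl a b d)
    (trans (+-congʳ ab≈ad) (-‿inverseʳ (a * d)))) (*≉0 a (b - d) a≉0 b-d≉0)

  -- Long division, recursing on the coefficients of a: if a = s b + r, then `x ∷ a` is t s b plus
  -- `x ∷ r`, and `x ∷ r` has degree at most `deg b`, so one multiple of b reduces it.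
  divide : ∀ b → b ≉ 0# → ∀ a → ∃[ s ] ∃[ r ] a ≈ s * b + r × VanishesFrom (deg b) r
  divide b b≉0 []      = 0# , 0# , refl , λ _ _ → F.refl
  divide b b≉0 (x ∷ a) with divide b b≉0 a
  ... | s , r , a≈sb+r , v = (F.0# ∷ s) + const κ , r′ , eq , vr′
    where
    β    = proj₁ (F.inverse (leading≉0 b b≉0))
    -- Chosen so that κ b and `x ∷ r` have the same coefficient at `deg b`.
    κ    = coeff (x ∷ r) (deg b) F.* β
    r′   = (x ∷ r) - const κ * b
    κb≈ : coeff (const κ * b) (deg b) F.≈ coeff (x ∷ r) (deg b)
    κb≈ = F.trans (at (P.const-* κ b) (deg b)) (F.trans (P.coeff-· κ b (deg b))
      (F.trans (F.*-assoc _ β _)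
        (F.trans (F.*-congˡ (proj₁ (proj₂ (F.inverse (leading≉0 b b≉0))))) (F.*-identityʳ _))))
    vxr : VanishesFrom (suc (deg b)) (x ∷ r)
    vxr (suc k) (s≤s d≤k) = v k d≤k
    vκb : VanishesFrom (suc (deg b)) (const κ * b)
    vκb k d<k = F.trans (at (P.const-* κ b) k) (F.trans (P.coeff-· κ b k)
      (F.trans (F.*-congˡ (deg-vanishes b k d<k)) (F.zeroʳ κ)))
    vr′ : VanishesFrom (deg b) r′
    vr′ k d≤k with ℕ.m≤n⇒m<n∨m≡n d≤k
    ... | inj₁ d<k    = vanishes-− (x ∷ r) (const κ * b) vxr vκb k d<k
    ... | inj₂ ≡.refl = F.trans (P.coeff-+ (x ∷ r) (- (const κ * b)) (deg b))
      (F.trans (F.+-congˡ (F.trans (P.coeff-neg (const κ * b) (deg b)) (F.-‿cong κb≈)))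
        (F.-‿inverseʳ _))
    shift : x ∷ a ≈ (F.0# ∷ s) * b + (x ∷ r)
    shift = begin
      x ∷ a                              ≈⟨ ∷-cong (F.sym (F.+-identityˡ x)) a≈sb+r ⟩
      (F.0# ∷ s * b) + (x ∷ r)           ≈⟨ +-congʳ {x ∷ r} (P.0∷-*-assoc s b) ⟨
      (F.0# ∷ s) * b + (x ∷ r)           ∎
      where open SetoidReasoning setoid
    eq : x ∷ a ≈ ((F.0# ∷ s) + const κ) * b + r′
    eq = trans shift (solve 4 (λ t k b y → t :* b :+ y := (t :+ k) :* b :+ (y :- k :* b))
      refl (F.0# ∷ s) (const κ) b (x ∷ r))

  infixl 7 _mod_
  _mod_ : Poly → ∀ {b} → b ≉ 0# → Poly
  a mod b≉0 = proj₁ (proj₂ (divide _ b≉0 a))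

  mod-≡ : ∀ {b} (b≉0 : b ≉ 0#) a → a ≡ a mod b≉0 [mod b ]
  mod-≡ {b} b≉0 a with divide b b≉0 a
  ... | s , r , a≈sb+r , _ = s , trans
    (solve 3 (λ s b r → s :* b := (s :* b :+ r) :- r) refl s b r) (+-congʳ (sym a≈sb+r))

  mod-vanishes : ∀ {b} (b≉0 : b ≉ 0#) a → VanishesFrom (deg b) (a mod b≉0)
  mod-vanishes b≉0 a = proj₂ (proj₂ (proj₂ (divide _ b≉0 a)))

  ≡∧vanishes⇒≈ : ∀ {a} b d → VanishesFrom (deg a) b → VanishesFrom (deg a) d →
                 b ≡ d [mod a ] → b ≈ d
  ≡∧vanishes⇒≈ {a} b d vb vd b≡d =
    x-y≈0⇒x≈y b d (∣∧vanishes⇒≈0 (b - d) b≡d (vanishes-− b d vb vd))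

  mod-cong : ∀ {b} (b≉0 : b ≉ 0#) x y → x ≡ y [mod b ] → x mod b≉0 ≈ y mod b≉0
  mod-cong {b} b≉0 x y x≡y = ≡∧vanishes⇒≈ {b} (x mod b≉0) (y mod b≉0)
    (mod-vanishes b≉0 x) (mod-vanishes b≉0 y)
    (B.trans {x mod b≉0} {x} {y mod b≉0} (B.sym {x} {x mod b≉0} (mod-≡ b≉0 x))
      (B.trans {x} {y} {y mod b≉0} x≡y (mod-≡ b≉0 y)))
    where module B = Setoid (Residue b)

  ∣? : ∀ {a} → a ≉ 0# → ∀ b → Dec (a ∣ b)
  ∣? {a} a≉0 b with (b mod a≉0) ≟0
  ... | yes r≈0 = yes (∣-+-cancel {b = - (b mod a≉0)} (mod-≡ a≉0 b)
    (∣-neg (0# , trans (zeroˡ a) (sym r≈0))))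
  ... | no  r≉0 = no λ a∣b → r≉0 (∣∧vanishes⇒≈0 (b mod a≉0)
    (∣ʳ-respʳ-≈ (solve 2 (λ b r → b :- (b :- r) := r) refl b (b mod a≉0))
      (∣-− a∣b (mod-≡ a≉0 b))) (mod-vanishes a≉0 b))

  irreducible⇒nonConstant : ∀ {p} → Irreducible p → NonConstant p
  irreducible⇒nonConstant {p} irr with 1 ℕ.≤? deg p
  ... | yes nc = nc
  ... | no  c  = contradiction
    (deg-0⇒∣1 p (Primality.Irreducible⇒≉0 semiring (1≉0 ∘ sym) irr) (ℕ.n<1⇒n≡0 (ℕ.≰⇒> c)))
    (Irreducible.p∤1 irr)

  ∣1⇒deg≡0 : ∀ {u} → u ∣ 1# → deg u ≡ 0
  ∣1⇒deg≡0 {u} u∣1 with 1 ℕ.≤? deg u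
  ... | yes nc = contradiction u∣1 (NonConstant⇒∤1 nc)
  ... | no  c  = ℕ.n<1⇒n≡0 (ℕ.≰⇒> c)

  -- By irreducibility the cofactor is a unit, hence constant, and comparing leading coefficients
  -- makes it 1.
  monic-∣⇒≈ : ∀ {Q R} → Monic Q → Monic R → NonConstant Q → Irreducible R → Q ∣ R → Q ≈ R
  monic-∣⇒≈ {Q} {R} mQ mR ncQ irrR (u , uQ≈R) with Irreducible.split-∣1 irrR {u} {Q} (sym uQ≈R)
  ... | inj₂ Q∣1 = contradiction Q∣1 (NonConstant⇒∤1 ncQ)
  ... | inj₁ u∣1 = sym (begin
    R                        ≈⟨ R≈uQ ⟩
    const (leading u) * Q    ≈⟨ *-congʳ {Q} {const (leading u)} {1#} (∷-cong u≈1 refl) ⟩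
    1# * Q                   ≈⟨ *-identityˡ Q ⟩
    Q                        ∎)
    where
    open SetoidReasoning setoid
    R≈uQ : R ≈ const (leading u) * Q
    R≈uQ = trans (sym uQ≈R) (*-congʳ (deg-0⇒const u (∣1⇒deg≡0 u∣1)))
    u≉0 : u ≉ 0#
    u≉0 u≈0 = NonConstant⇒≉0 (irreducible⇒nonConstant irrR)
      (trans (sym uQ≈R) (trans (*-congʳ {Q} {u} {0#} u≈0) (zeroˡ Q)))
    degR≡degQ : deg R ≡ deg Q
    degR≡degQ = ≡.trans (≡.sym (deg-cong {u * Q} uQ≈R)) (≡.trans (deg-* u Q u≉0 (NonConstant⇒≉0 ncQ))
      (≡.cong (ℕ._+ deg Q) (∣1⇒deg≡0 u∣1)))
    u≈1 : leading u F.≈ F.1#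
    u≈1 = F.trans (F.sym (F.*-identityʳ _)) (F.trans (F.*-congˡ (F.sym mQ))
      (F.trans (F.sym (P.coeff-· (leading u) Q (deg Q)))
        (F.trans (F.sym (at (P.const-* (leading u) Q) (deg Q)))
          (F.trans (F.sym (at R≈uQ (deg Q)))
            (F.trans (F.reflexive (≡.cong (coeff R) (≡.sym degR≡degQ))) mR)))))

  below-vanishes : ∀ n {a} → a ∈ below n → VanishesFrom n a
  below-vanishes zero    (here ≡.refl) k _ = F.refl
  below-vanishes (suc n) a∈ with ∈-cartesianProductWith⁻ _∷_
    (map (Inverse.from F.enumeration) (allFin q)) (below n) a∈
  ... | x , b , _ , b∈ , ≡.refl = λ where
    (suc k) (s≤s n≤k) → below-vanishes n b∈ k n≤k

  decSetoid : DecSetoid c ℓ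
  decSetoid = record
    { isDecEquivalence = record { isEquivalence = isEquivalence ; _≟_ = _≟_ } }

  residues : ℕ → List Poly
  residues m = deduplicate _≟_ (below m)

  residues-distinct : ∀ m → AllPairs _≉_ (residues m)
  residues-distinct m = Unique.deduplicate-! decSetoid (below m)

  residues-vanish : ∀ m → All (VanishesFrom m) (residues m)
  residues-vanish m = All.deduplicate⁺ _≟_ (All.tabulate (below-vanishes m))

  residues-complete : ∀ m x → VanishesFrom m x → Any (x ≈_) (residues m)
  residues-complete m x vx = let (x′ , x′∈ , x′≈x) = below-complete m x vx in
    Any.deduplicate⁺ _≟_ (λ b≈a x≈a → trans x≈a (sym b≈a)) (lose x′∈ (sym x′≈x))

  Chen⇒ChenPair : ∀ f g → Chen (VanishesFrom (deg f)) g → ChenPair 𝔽 f g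
  Chen⇒ChenPair f g chen σ pr
    with chen (Func.to σ) (λ x y vx vy → pr x y (vanishes⇒reduced f x vx) (vanishes⇒reduced f y vy))
  ... | G , G≡σ = G , λ h r →
    Setoid.sym (Residue g) {eval G h} {Func.to σ h} (G≡σ h (reduced⇒vanishes f h r))

  ChenPair⇒interpolates : ∀ f g → NonConstant f → ChenPair 𝔽 f g → (σ : Poly → Poly) →
    (∀ x y → x ≡ y [mod f ] → σ x ≈ σ y) →
    Preserves (VanishesFrom (deg f)) g σ → Interpolates (VanishesFrom (deg f)) g σ
  ChenPair⇒interpolates f g nc chen σ σ-cong pr
    with chen (record { to = σ ; cong = λ {x} {y} e → ≈⇒≡ {g} {σ x} {σ y} (σ-cong x y e) })
      (λ x y rx ry → pr x y (reduced⇒vanishes f x rx) (reduced⇒vanishes f y ry))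
  ... | G , σ≡G = G , λ x vx →
    Setoid.sym (Residue g) {σ x} {eval G x} (σ≡G x (vanishes⇒reduced f x vx))

  -- The polynomials of degree below `deg g` already represent every class modulo g, so enlarging
  -- the domain adds no condition.
  chen-complete : ∀ {m n} g → g ≉ 0# → m ≡ deg g → m ℕ.≤ n →
    Chen (VanishesFrom m) g → Chen (VanishesFrom n) g
  chen-complete g g≉0 ≡.refl m≤n = chen-representatives
    (λ {x} → vanishes-≤ x m≤n) (λ x → x mod g≉0 , mod-≡ g≉0 x , mod-vanishes g≉0 x)

  -- Comaximality and sparse sets for an irreducible polynomial.

  module Prime {p} (p-nonConstant : NonConstant p) (p-irreducible : Irreducible p) where

    open Irreducible p-irreducible using () renaming (split-∣1 to split)

    p≉0 : p ≉ 0#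
    p≉0 = NonConstant⇒≉0 p-nonConstant

    -- Euclid's algorithm, dividing p itself by the current remainder: a
    -- proper divisor of p cannot occur, so the remainder never vanishes.
    comaximal-reduced : ∀ n a → deg a ℕ.≤ n → a ≉ 0# → VanishesFrom (deg p) a → Comaximal a p
    comaximal-reduced n a d≤n a≉0 v with 1 ℕ.≤? deg a
    ... | no  a-constant = comaximal-∣1 p (deg-0⇒∣1 a a≉0 (ℕ.n<1⇒n≡0 (ℕ.≰⇒> a-constant)))
    comaximal-reduced zero    a d≤n a≉0 v | yes nc = contradiction (ℕ.≤-trans nc d≤n) λ ()
    comaximal-reduced (suc n) a d≤n a≉0 v | yes nc with divide a a≉0 p
    ... | s , r , p≈sa+r , vr with r ≟0
    ... | yes r≈0 = contradiction
      (split (trans p≈sa+r (trans (+-congˡ {s * a} r≈0) (+-identityʳ _)))) λ where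
        (inj₂ a∣1)       → NonConstant⇒∤1 nc a∣1
        -- Multiplying p = s a by w gives w p = a, so p would divide a non-zero polynomial of
        -- smaller degree.
        (inj₁ (w , ws≈1)) → a≉0 (∣∧vanishes⇒≈0 a (w , (begin
          w * p          ≈⟨ *-congˡ {w} p≈sa+r ⟩
          w * (s * a + r) ≈⟨ *-congˡ {w} (trans (+-congˡ {s * a} r≈0) (+-identityʳ _)) ⟩
          w * (s * a)    ≈⟨ *-assoc w s a ⟨
          w * s * a      ≈⟨ *-congʳ ws≈1 ⟩
          1# * a         ≈⟨ *-identityˡ a ⟩
          a              ∎)) v)
      where open SetoidReasoning setoid
    ... | no  r≉0 with comaximal-reduced n r
      (ℕ.≤-pred (ℕ.≤-trans (vanishes⇒deg< r r≉0 vr) d≤n)) r≉0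
      (vanishes-≤ r (ℕ.<⇒≤ (vanishes⇒deg< a a≉0 v)) vr)
    -- The Bézout identity for r and p, with r replaced by p - s a.
    ... | u , w , e = - (u * s) , u + w , (begin
      - (u * s) * a + (u + w) * p
        ≈⟨ solve 5 (λ u s a w p → :- (u :* s) :* a :+ (u :+ w) :* p :=
                                  u :* (p :- s :* a) :+ w :* p) refl u s a w p ⟩
      u * (p - s * a) + w * p
        ≈⟨ +-congʳ (*-congˡ {u} (+-congʳ p≈sa+r)) ⟩
      u * (s * a + r - s * a) + w * p
        ≈⟨ +-congʳ (*-congˡ {u} (solve 2 (λ y r → y :+ r :- y := r) refl (s * a) r)) ⟩
      u * r + w * p
        ≈⟨ e ⟩
      1#
        ∎)
      where open SetoidReasoning setoid

    ∤⇒comaximal : ∀ {a} → p ∤ a → Comaximal a p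
    ∤⇒comaximal {a} p∤a with divide p p≉0 a
    ... | s , r , a≈sp+r , vr with comaximal-reduced (deg r) r ℕ.≤-refl
      (λ r≈0 → p∤a (s , sym (trans a≈sp+r (trans (+-congˡ {s * p} r≈0) (+-identityʳ _))))) vr
    ... | u , w , e = u , w - u * s , (begin
      u * a + (w - u * s) * p
        ≈⟨ +-congʳ (*-congˡ {u} a≈sp+r) ⟩
      u * (s * p + r) + (w - u * s) * p
        ≈⟨ solve 5 (λ u s p r w → u :* (s :* p :+ r) :+ (w :- u :* s) :* p :=
                                  u :* r :+ w :* p) refl u s p r w ⟩
      u * r + w * p
        ≈⟨ e ⟩
      1#
        ∎)
      where open SetoidReasoning setoid

    open ChenTheory.AtPrime 𝔸 p (∣? p≉0) ∤⇒comaximal public using (Sparse; chen-sparse)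

    chen-primePower : ∀ {m} e → Sparse (VanishesFrom m) → Chen (VanishesFrom m) (p ^ suc e)
    chen-primePower {m} e S =
      chen-sparse e S (residues m) (residues-vanish m) (residues-distinct m) (residues-complete m)

    -- Polynomials of degree below `deg p` that are congruent modulo p coincide, so both conditions
    -- hold vacuously.
    sparse-residues : ∀ {m} → m ℕ.≤ deg p → Sparse (VanishesFrom m)
    sparse-residues {m} m≤d = record
      { pairs   = λ x y vx vy x≉y pp∣ → x≉y (equal x y vx vy (∣ʳ-trans (x∣ʳyx p p) pp∣))
      ; triples = λ x y z vx vy vz x≉y x≉z y≉z p∣ _ → x≉y (equal x y vx vy p∣)
      }
      where
      equal : ∀ x y → VanishesFrom m x → VanishesFrom m y → p ∣ x - y → x ≈ y
      equal x y vx vy = ≡∧vanishes⇒≈ {p} x y (vanishes-≤ x m≤d vx) (vanishes-≤ y m≤d vy)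

    -- Over 𝔽₂ the only non-zero multiple of p of degree at most deg p is p.
    sparse-𝔽₂ : (∀ {a} → a F.≉ F.0# → a F.≈ F.1#) →
                ∀ {m} → m ℕ.≤ suc (deg p) → Sparse (VanishesFrom m)
    sparse-𝔽₂ only1 {m} m≤1+d = record
      { pairs   = λ x y vx vy x≉y pp∣ → x≉y (≡∧vanishes⇒≈ {p * p} x y
                    (vanishes-≤ x m≤2d vx) (vanishes-≤ y m≤2d vy) pp∣)
      -- Both differences are equal to p, so y and z coincide.
      ; triples = λ x y z vx vy vz x≉y x≉z y≉z p∣x-y p∣x-z → y≉z (begin
          y              ≈⟨ solve 2 (λ x y → y := x :- (x :- y)) refl x y ⟩
          x - (x - y)    ≈⟨ +-congˡ {x} (-‿cong (trans (difference x y vx vy x≉y p∣x-y)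
                                            (sym (difference x z vx vz x≉z p∣x-z)))) ⟩
          x - (x - z)    ≈⟨ solve 2 (λ x z → x :- (x :- z) := z) refl x z ⟩
          z              ∎)
      }
      where
      open SetoidReasoning setoid
      -- As `deg p` is at least 1, `suc (deg p)` is at most twice `deg p`, so p² divides no non-zero
      -- difference.
      m≤2d : m ℕ.≤ deg (p * p)
      m≤2d = ≡.subst (m ℕ.≤_) (≡.sym (deg-* p p p≉0 p≉0))
        (ℕ.≤-trans m≤1+d (ℕ.+-monoˡ-≤ (deg p) p-nonConstant))
      difference : ∀ x y → VanishesFrom m x → VanishesFrom m y → x ≉ y → p ∣ x - y → x - y ≈ p
      difference x y vx vy x≉y (u , up≈) = begin
        x - y                    ≈⟨ up≈ ⟨
        u * p                    ≈⟨ *-congʳ (deg-0⇒const u deg-u≡0) ⟩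
        const (leading u) * p    ≈⟨ *-congʳ {p} {const (leading u)} {1#}
                                      (∷-cong (only1 (leading≉0 u u≉0)) refl) ⟩
        1# * p                   ≈⟨ *-identityˡ p ⟩
        p                        ∎
        where
        x-y≉0 : x - y ≉ 0#
        x-y≉0 e = x≉y (x-y≈0⇒x≈y x y e)
        u≉0 : u ≉ 0#
        u≉0 u≈0 = x-y≉0 (trans (sym up≈) (trans (*-congʳ {p} {u} {0#} u≈0) (zeroˡ p)))
        deg-u≡0 : deg u ≡ 0
        deg-u≡0 = ℕ.n<1⇒n≡0 (ℕ.+-cancelʳ-< (deg p) (deg u) 1 (≡.subst (ℕ._< suc (deg p))
          (≡.trans (deg-cong (sym up≈)) (deg-* u p u≉0 p≉0))
          (ℕ.≤-trans (vanishes⇒deg< (x - y) x-y≉0 (vanishes-− x y vx vy)) m≤1+d)))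

-- Points at which second differences obstruct interpolation.

module Obstructions {c ℓ q} (𝔽 : FiniteField c ℓ q) where

  private
    module F = FiniteField 𝔽
    module P = Polynomial F.commutativeRing

  open 𝔽[t] 𝔽
  open CommutativeRing 𝔸
  open P using (VanishesFrom)
  open Arithmetic 𝔽
  open Congruences 𝔸
  open Divisibility semiring using (_∣_; _∤_; _,_; ∣ʳ-respʳ-≈; ∣ʳ-respˡ-≈; ∣ʳ-refl; ∣ʳ-trans)
  open SemigroupDivisibility *-commutativeSemigroup using (x∣xy)
  open Primality semiring using (Irreducible)
  open Exp semiring using (_^_)
  open ChenTheory 𝔸 using (preserves-∣; module AtPrime)
  open ℤ-Solver 𝔸

  module _ {p} (p-nonConstant : NonConstant p) (p-irreducible : Irreducible p) where

    open Prime p-nonConstant p-irreducible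

    private
      p∤1 : p ∤ 1#
      p∤1 = NonConstant⇒∤1 p-nonConstant
      p-cancel : ∀ a b → p * a ≈ p * b → a ≈ b
      p-cancel a b = *-cancelˡ p a b p≉0
      module AtP = AtPrime p (∣? p≉0) ∤⇒comaximal

    p*-cancel-∣ : ∀ {a b} → p * a ∣ p * b → a ∣ b
    p*-cancel-∣ {a} {b} = AtP.*-cancel-∣ p∤1 p-cancel {a} {b}

    -- Taking the spike of the remainder modulo f gives a function on residue classes. The two
    -- divisibilities allow g to differ from `p ^ e * m` by a unit.
    obstruct : ∀ {f g m x y} e j → NonConstant f → p ^ e * m ∣ g → g ∣ p ^ e * m →
      Comaximal m p → j ℕ.< e → VanishesFrom (deg f) x → VanishesFrom (deg f) y →
      p ^ suc j ∣ x * y → p ^ suc j ∤ x → p ^ suc j ∤ y → p ^ suc j ∤ x + y →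
      ¬ ChenPair 𝔽 f g
    obstruct {f} {g} {m} {x} {y} e j f-nc pm∣g g∣pm m⊥p j<e vx vy d∣xy d∤x d∤y d∤x+y chen =
      Ob.σ-¬interpolates mod-id {x} {y} (λ _ _ → F.refl) vx vy (vanishes-+ x y vx vy)
        d∣xy d∤x d∤y d∤x+y (proj₁ G , λ z vz → ∣ʳ-trans pm∣g (proj₂ G z vz))
      where
      f≉0 = NonConstant⇒≉0 {f} f-nc
      module Ob = AtP.Obstruction p∤1 p-cancel m m⊥p e j j<e (λ a → a mod f≉0)
      mod-id : ∀ z → VanishesFrom (deg f) z → z mod f≉0 ≈ z
      mod-id z vz = sym (≡∧vanishes⇒≈ {f} z (z mod f≉0) vz (mod-vanishes f≉0 z) (mod-≡ f≉0 z))
      G = ChenPair⇒interpolates f g f-nc chen Ob.σ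
        (λ a b a≡b → Ob.σ-cong a b (mod-cong f≉0 a b a≡b))
        (preserves-∣ Ob.σ g∣pm (Ob.σ-preserves mod-id))

    -- The points are p a and p b: their product contains p², and cancelling p leaves the conditions
    -- on a, b and a + b.
    obstruct² : ∀ {f g m a b} e i → NonConstant f → p ^ e * m ∣ g → g ∣ p ^ e * m →
      Comaximal m p → 1 ℕ.< e → i ℕ.+ deg p ℕ.< deg f →
      VanishesFrom (suc i) a → VanishesFrom (suc i) b → p ∤ a → p ∤ b → p ∤ a + b →
      ¬ ChenPair 𝔽 f g
    obstruct² {f} {g} {m} {a} {b} e i f-nc pm∣g g∣pm m⊥p 1<e i+d<n va vb p∤a p∤b p∤a+b =
      obstruct {f} {g} {m} {p * a} {p * b} e 1 f-nc pm∣g g∣pm m⊥p 1<e (vp* a va) (vp* b vb)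
        (a * b , solve 3 (λ p a b → a :* b :* (p :* (p :* con (+ 1))) := (p :* a) :* (p :* b))
          refl p a b)
        (p∤a ∘ square a) (p∤b ∘ square b)
        (p∤a+b ∘ square (a + b) ∘ ∣ʳ-respʳ-≈ (sym (distribˡ p a b)))
      where
      vp* : ∀ a → VanishesFrom (suc i) a → VanishesFrom (deg f) (p * a)
      vp* a va = vanishes-resp (a * p) (p * a) (*-comm a p)
        (vanishes-≤ (a * p) i+d<n (P.*-vanishes a p va (deg-vanishes p)))
      square : ∀ a → p ^ 2 ∣ p * a → p ∣ a
      square a = ∣ʳ-respˡ-≈ (*-identityʳ p) ∘ p*-cancel-∣ {p ^ 1} {a}

    -- Meant for q = 2 and linear p, where the residue field has two elements: there a + b is a
    -- multiple of p whenever a and b are not, so `obstruct²` cannot be applied.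
    obstruct³ : ∀ {f g m} e → NonConstant f → p ^ e * m ∣ g → g ∣ p ^ e * m →
      Comaximal m p → 2 ℕ.< e → deg p ℕ.+ deg p ℕ.< deg f → ¬ ChenPair 𝔽 f g
    obstruct³ {f} {g} {m} e f-nc pm∣g g∣pm m⊥p 2<e 2d<n =
      obstruct {f} {g} {m} {p} {p * p} e 2 f-nc pm∣g g∣pm m⊥p 2<e
        (deg<⇒vanishes p (ℕ.≤-<-trans (ℕ.m≤m+n (deg p) (deg p)) 2d<n))
        (vanishes-≤ (p * p) 2d<n (P.*-vanishes p p (deg-vanishes p) (deg-vanishes p)))
        (1# , solve 1 (λ p → con (+ 1) :* (p :* (p :* (p :* con (+ 1)))) := p :* (p :* p)) refl p)
        (λ d → p∤1 (cube 1# (∣ʳ-respʳ-≈ (sym (*-identityʳ p)) d)))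
        (λ d → p∤1 (∣ʳ-respˡ-≈ (*-identityʳ p)
          (p*-cancel-∣ {p ^ 1} {1#} (∣ʳ-respʳ-≈ (sym (*-identityʳ p)) (p*-cancel-∣ {p ^ 2} {p} d)))))
        -- The sum of the points is p (1 + p), and p does not divide 1 + p.
        (λ d → p∤1 (∣-+-cancel {p} {1#} {p} (cube (1# + p)
          (∣ʳ-respʳ-≈ (solve 1 (λ p → p :+ p :* p := p :* (con (+ 1) :+ p)) refl p) d)) ∣ʳ-refl))
      where
      cube : ∀ a → p ^ 3 ∣ p * a → p ∣ a
      cube a = ∣ʳ-trans (x∣xy p (p ^ 1)) ∘ p*-cancel-∣ {p ^ 2} {a}

-- Minima of extended natural numbers.

module _ {n : ℕ} where

  <⁺-⊓⁺ : ∀ a b → [ n ] <⁺ a → [ n ] <⁺ b → [ n ] <⁺ (a ⊓⁺ b)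
  <⁺-⊓⁺ ⊤⁺    b     _     n<b   = n<b
  <⁺-⊓⁺ [ a ] ⊤⁺    n<a   _     = n<a
  <⁺-⊓⁺ [ a ] [ b ] [ p ] [ r ] = [ ℕ.⊓-glb p r ]

  <⁺-⊓⁺ˡ : ∀ a b → [ n ] <⁺ (a ⊓⁺ b) → [ n ] <⁺ a
  <⁺-⊓⁺ˡ ⊤⁺    b     _     = [ n ]<⊤⁺
  <⁺-⊓⁺ˡ [ a ] ⊤⁺    n<a   = n<a
  <⁺-⊓⁺ˡ [ a ] [ b ] [ p ] = [ ℕ.m<n⊓o⇒m<n a b p ]

  <⁺-⊓⁺ʳ : ∀ a b → [ n ] <⁺ (a ⊓⁺ b) → [ n ] <⁺ b
  <⁺-⊓⁺ʳ ⊤⁺    b     n<b   = n<b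
  <⁺-⊓⁺ʳ [ a ] ⊤⁺    _     = [ n ]<⊤⁺
  <⁺-⊓⁺ʳ [ a ] [ b ] [ p ] = [ ℕ.m<n⊓o⇒m<o a b p ]

  module _ {a} {A : Set a} (w : A → ℕ ⁺) where

    minimum : List A → ℕ ⁺
    minimum = foldr (λ x m → w x ⊓⁺ m) ⊤⁺

    All⇒<⁺minimum : ∀ {xs} → All (λ x → [ n ] <⁺ w x) xs → [ n ] <⁺ minimum xs
    All⇒<⁺minimum []       = [ n ]<⊤⁺
    All⇒<⁺minimum {x ∷ xs} (p ∷ ps) = <⁺-⊓⁺ (w x) (minimum xs) p (All⇒<⁺minimum ps)

    <⁺minimum⇒All : ∀ xs → [ n ] <⁺ minimum xs → All (λ x → [ n ] <⁺ w x) xs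
    <⁺minimum⇒All []       _ = []
    <⁺minimum⇒All (x ∷ xs) p = <⁺-⊓⁺ˡ (w x) (minimum xs) p
                             ∷ <⁺minimum⇒All xs (<⁺-⊓⁺ʳ (w x) (minimum xs) p)

-- Case distinction on γ at prime powers.

data Unobstructed (q d e n : ℕ) : Set where
  small     : n ℕ.≤ d → Unobstructed q d e n
  small-𝔽₂  : q ≡ 2 → n ℕ.≤ suc d → Unobstructed q d e n
  prime     : e ≡ 1 → Unobstructed q d e n
  square-𝔽₂ : q ≡ 2 → d ≡ 1 → e ≡ 2 → Unobstructed q d e n

-- Sorted by the points that will be used: multiples of P by constants for `large`, P and t P for
-- `large-𝔽₂`, P and P² for `linear-𝔽₂`. Here n is `deg f` and d is `deg P`.
data Obstructed (q d e n : ℕ) : Set where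
  large      : 3 ℕ.≤ q → 2 ℕ.≤ e → d ℕ.< n → Obstructed q d e n
  large-𝔽₂   : q ≡ 2 → 2 ℕ.≤ e → 2 ℕ.≤ d → suc d ℕ.< n → Obstructed q d e n
  linear-𝔽₂  : q ≡ 2 → d ≡ 1 → 3 ℕ.≤ e → 2 ℕ.< n → Obstructed q d e n

-- The clauses follow the case split of `γ-primePower`, so that it reduces in each of them. An
-- infinite value leads to `prime` or `square-𝔽₂`, a finite one to a bound on n.
<γ⇒Unobstructed : ∀ q d e n → 2 ℕ.≤ q → 1 ℕ.≤ d → 1 ℕ.≤ e →
  [ n ] <⁺ γ-primePower q d e → Unobstructed q d e n
<γ⇒Unobstructed (suc zero) d e n (s≤s ())
<γ⇒Unobstructed 2 d 1 n _ _ _ _ = prime ≡.refl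
<γ⇒Unobstructed 2 1 2 n _ _ _ _ = square-𝔽₂ ≡.refl ≡.refl ≡.refl
<γ⇒Unobstructed 2 d@(suc (suc _)) 2 n _ _ _ [ n<d+2 ] =
  small-𝔽₂ ≡.refl (ℕ.m<1+n⇒m≤n (≡.subst (n ℕ.<_) (ℕ.+-comm d 2) n<d+2))
<γ⇒Unobstructed 2 1 (suc (suc (suc e))) n _ _ _ [ n<3 ] = small-𝔽₂ ≡.refl (ℕ.m<1+n⇒m≤n n<3)
<γ⇒Unobstructed 2 d@(suc (suc _)) (suc (suc (suc e))) n _ _ _ [ n<d+2 ] =
  small-𝔽₂ ≡.refl (ℕ.m<1+n⇒m≤n (≡.subst (n ℕ.<_) (ℕ.+-comm d 2) n<d+2))
<γ⇒Unobstructed (suc (suc (suc q))) d 1 n _ _ _ _ = prime ≡.refl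
<γ⇒Unobstructed (suc (suc (suc q))) d (suc (suc e)) n _ _ _ [ n<d+1 ] =
  small (ℕ.m<1+n⇒m≤n (≡.subst (n ℕ.<_) (ℕ.+-comm d 1) n<d+1))

≮γ⇒Obstructed : ∀ q d e n → 2 ℕ.≤ q → 1 ℕ.≤ d → 1 ℕ.≤ e →
  ¬ ([ n ] <⁺ γ-primePower q d e) → Obstructed q d e n
≮γ⇒Obstructed (suc zero) d e n (s≤s ())
≮γ⇒Obstructed 2 d 1 n _ _ _ n≮ = contradiction [ n ]<⊤⁺ n≮
≮γ⇒Obstructed 2 1 2 n _ _ _ n≮ = contradiction [ n ]<⊤⁺ n≮
≮γ⇒Obstructed 2 d@(suc (suc _)) 2 n _ _ _ n≮ = large-𝔽₂ ≡.refl ℕ.≤-refl (s≤s (s≤s z≤n))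
  (≡.subst (ℕ._≤ n) (ℕ.+-comm d 2) (ℕ.≮⇒≥ (n≮ ∘ [_])))
≮γ⇒Obstructed 2 1 (suc (suc (suc e))) n _ _ _ n≮ = linear-𝔽₂ ≡.refl ≡.refl (s≤s (s≤s (s≤s z≤n)))
  (ℕ.≮⇒≥ (n≮ ∘ [_]))
≮γ⇒Obstructed 2 d@(suc (suc _)) (suc (suc (suc e))) n _ _ _ n≮ =
  large-𝔽₂ ≡.refl (s≤s (s≤s z≤n)) (s≤s (s≤s z≤n))
  (≡.subst (ℕ._≤ n) (ℕ.+-comm d 2) (ℕ.≮⇒≥ (n≮ ∘ [_])))
≮γ⇒Obstructed (suc (suc (suc q))) d 1 n _ _ _ n≮ = contradiction [ n ]<⊤⁺ n≮
≮γ⇒Obstructed (suc (suc (suc q))) d (suc (suc e)) n _ _ _ n≮ =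
  large (s≤s (s≤s (s≤s z≤n))) (s≤s (s≤s z≤n))
  (≡.subst (ℕ._≤ n) (ℕ.+-comm d 1) (ℕ.≮⇒≥ (n≮ ∘ [_])))

-- Elements of fields of size two and of size at least three.

Fin₂-dichotomy : ∀ (i j k : Fin 2) → i ≢ j → k ≢ j → i ≡ k
Fin₂-dichotomy zero       zero       _          i≢j _   = contradiction ≡.refl i≢j
Fin₂-dichotomy zero       (suc zero) zero       _   _   = ≡.refl
Fin₂-dichotomy zero       (suc zero) (suc zero) _   k≢j = contradiction ≡.refl k≢j
Fin₂-dichotomy (suc zero) zero       zero       _   k≢j = contradiction ≡.refl k≢j
Fin₂-dichotomy (suc zero) zero       (suc zero) _   _   = ≡.refl
Fin₂-dichotomy (suc zero) (suc zero) _          i≢j _   = contradiction ≡.refl i≢j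

Fin-avoid₂ : ∀ {n} → 3 ℕ.≤ n → (j k : Fin n) → ∃[ i ] i ≢ j × i ≢ k
Fin-avoid₂ (s≤s (s≤s (s≤s _))) zero          zero          = suc zero , (λ ()) , λ ()
Fin-avoid₂ (s≤s (s≤s (s≤s _))) zero          (suc zero)    = suc (suc zero) , (λ ()) , λ ()
Fin-avoid₂ (s≤s (s≤s (s≤s _))) zero          (suc (suc k)) = suc zero , (λ ()) , λ ()
Fin-avoid₂ (s≤s (s≤s (s≤s _))) (suc zero)    zero          = suc (suc zero) , (λ ()) , λ ()
Fin-avoid₂ (s≤s (s≤s (s≤s _))) (suc (suc j)) zero          = suc zero , (λ ()) , λ ()
Fin-avoid₂ (s≤s (s≤s (s≤s _))) (suc j)       (suc k)       = zero , (λ ()) , λ ()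

module FieldSize {c ℓ q} (𝔽 : FiniteField c ℓ q) where

  open FiniteField 𝔽
  open Inverse enumeration using (to; from; to-cong; inverseˡ; inverseʳ)

  to-injective : ∀ {x y} → to x ≡ to y → x ≈ y
  to-injective e = trans (sym (inverseʳ ≡.refl)) (inverseʳ e)

  2≤q : 2 ℕ.≤ q
  2≤q = distinct⇒2≤ (to 1#) (to 0#) (1≉0 ∘ to-injective)
    where
    distinct⇒2≤ : ∀ {n} (i j : Fin n) → i ≢ j → 2 ℕ.≤ n
    distinct⇒2≤ {suc zero}    zero zero i≢j = contradiction ≡.refl i≢j
    distinct⇒2≤ {suc (suc n)} i    j    i≢j = s≤s (s≤s z≤n)

  q≡2⇒≈1 : q ≡ 2 → ∀ {x} → x ≉ 0# → x ≈ 1#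
  q≡2⇒≈1 ≡.refl {x} x≉0 = to-injective
    (Fin₂-dichotomy (to x) (to 0#) (to 1#) (x≉0 ∘ to-injective) (1≉0 ∘ to-injective))

  3≤q⇒avoid₂ : 3 ℕ.≤ q → ∀ y z → ∃[ x ] x ≉ y × x ≉ z
  3≤q⇒avoid₂ 3≤q y z = let (i , i≢y , i≢z) = Fin-avoid₂ 3≤q (to y) (to z) in
    from i , i≢y ∘ index , i≢z ∘ index
    where
    index : ∀ {i x} → from i ≈ x → i ≡ to x
    index e = ≡.trans (≡.sym (inverseˡ refl)) (to-cong e)

-- Assembling the prime power factors of g.

module Characterisation {c ℓ q} (𝔽 : FiniteField c ℓ q) where

  private
    module F = FiniteField 𝔽
    module P = Polynomial F.commutativeRing

  open 𝔽[t] 𝔽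
  open CommutativeRing 𝔸
  open P using (VanishesFrom; at)
  open Arithmetic 𝔽
  open Congruences 𝔸
  open Divisibility semiring using (_∣_; _,_; ∣ʳ-respʳ-≈; ∣ʳ-respˡ-≈; ∣ʳ-refl)
  open Primality semiring using (Irreducible)
  open Exp semiring using (_^_)
  open ChenTheory 𝔸 using (Chen; chen-1; chen-*; chen-resp)
  open Obstructions 𝔽 using (obstruct²; obstruct³)
  open FieldSize 𝔽
  open ℤ-Solver 𝔸

  -- If R divided Q, these two monic irreducibles would be equal.
  distinct⇒comaximal : ∀ {Q R k l} → PrimeFactor (Q , k) → PrimeFactor (R , l) →
                       Q ≉ R → Comaximal Q R
  distinct⇒comaximal {Q} {R} (mQ , iQ , _) (mR , iR , _) Q≉R =
    Prime.∤⇒comaximal (irreducible⇒nonConstant iR) iR {Q}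
      (λ R∣Q → Q≉R (sym (monic-∣⇒≈ mR mQ (irreducible⇒nonConstant iR) iQ R∣Q)))

  ∏-comaximal : ∀ {Q k fs} → PrimeFactor (Q , k) → All PrimeFactor fs →
                All (Distinct (Q , k)) fs → Comaximal (∏ fs) Q
  ∏-comaximal pf []         []         = comaximal-∣1 _ ∣ʳ-refl
  ∏-comaximal {Q} {fs = (R , l) ∷ fs} pf (pR ∷ ps) (Q≉R ∷ ds) =
    comaximal-* {R ^ l} {∏ fs} {Q}
      (comaximal-^ l (distinct⇒comaximal pR pf (Q≉R ∘ sym))) (∏-comaximal pf ps ds)

  -- The cofactor is built from powers of primes other than Q, each comaximal with Q; `obstruct`
  -- needs g split in this way.
  cofactor : ∀ {fs Q k} → All PrimeFactor fs → AllPairs Distinct fs → (Q , k) ∈ fs →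
             ∃[ m ] ∏ fs ≈ Q ^ k * m × Comaximal m Q
  cofactor {(Q , k) ∷ fs} (pf ∷ ps) (ds ∷ _) (here ≡.refl) = ∏ fs , refl , ∏-comaximal pf ps ds
  cofactor {(R , l) ∷ fs} {Q} {k} (pf ∷ ps) (ds ∷ dss) (there Q∈) =
    let (m , ∏≈ , m⊥Q) = cofactor ps dss Q∈ in
      R ^ l * m
    , trans (*-congˡ {R ^ l} ∏≈)
        (solve 3 (λ r s m → r :* (s :* m) := s :* (r :* m)) refl (R ^ l) (Q ^ k) m)
    , comaximal-* {R ^ l} {m} {Q}
        (comaximal-^ l (distinct⇒comaximal pf (All.lookup ps Q∈) (All.lookup ds Q∈))) m⊥Q

  chen-∏ : ∀ {n fs} → All PrimeFactor fs → AllPairs Distinct fs →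
           All (λ (Q , k) → Chen (VanishesFrom n) (Q ^ k)) fs → Chen (VanishesFrom n) (∏ fs)
  chen-∏ []        []         []               = chen-1 _
  chen-∏ {fs = (Q , k) ∷ fs} (pf ∷ ps) (ds ∷ dss) (chen ∷ chens) =
    chen-* {a = Q ^ k} {∏ fs} (comaximal-^ k (comaximal-sym {∏ fs} {Q} (∏-comaximal pf ps ds)))
      chen (chen-∏ ps dss chens)

  ^≉0 : ∀ {Q} → Q ≉ 0# → ∀ k → Q ^ k ≉ 0#
  ^≉0 {Q} Q≉0 zero    = 1≉0
  ^≉0 {Q} Q≉0 (suc k) = *≉0 Q (Q ^ k) Q≉0 (^≉0 Q≉0 k)

  deg-^ : ∀ {Q} → Q ≉ 0# → ∀ k → deg (Q ^ k) ≡ k ℕ.* deg Q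
  deg-^ {Q} Q≉0 zero    = ≡.refl
  deg-^ {Q} Q≉0 (suc k) =
    ≡.trans (deg-* Q (Q ^ k) Q≉0 (^≉0 Q≉0 k)) (≡.cong (deg Q ℕ.+_) (deg-^ Q≉0 k))

  module _ {Q} (irr : Irreducible Q) where

    open Prime (irreducible⇒nonConstant irr) irr

    -- This is the case of infinite γ: up to degree bound b the domain is sparse, and beyond b it
    -- contains a complete sparse set of representatives.
    chen-bounded : ∀ {n} b k → deg (Q ^ suc k) ℕ.≤ b →
      (∀ {m} → m ℕ.≤ b → Sparse (VanishesFrom m)) → Chen (VanishesFrom n) (Q ^ suc k)
    chen-bounded {n} b k deg≤b sparse = [ chen-primePower k ∘ sparse , complete ]′ (ℕ.≤-<-connex n b)
      where
      complete : b ℕ.< n → Chen (VanishesFrom n) (Q ^ suc k)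
      complete b<n = chen-complete (Q ^ suc k) (^≉0 p≉0 (suc k)) ≡.refl
        (ℕ.≤-trans deg≤b (ℕ.<⇒≤ b<n)) (chen-primePower k (sparse deg≤b))

    unobstructed⇒chen : ∀ {n k} → 1 ℕ.≤ k → Unobstructed q (deg Q) k n →
                        Chen (VanishesFrom n) (Q ^ k)
    unobstructed⇒chen {k = suc k} _ (small n≤d)         = chen-primePower k (sparse-residues n≤d)
    unobstructed⇒chen {k = suc k} _ (small-𝔽₂ ≡2 n≤1+d) =
      chen-primePower k (sparse-𝔽₂ (q≡2⇒≈1 ≡2) n≤1+d)
    unobstructed⇒chen             _ (prime ≡.refl)      = chen-bounded (deg Q) 0
      (ℕ.≤-reflexive (≡.trans (deg-^ p≉0 1) (ℕ.*-identityˡ (deg Q)))) sparse-residues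
    -- Here Q² has degree 2 = `suc (deg Q)`, exactly the bound up to which `sparse-𝔽₂` applies.
    unobstructed⇒chen             _ (square-𝔽₂ ≡2 d≡1 ≡.refl) = chen-bounded (suc (deg Q)) 1
      (ℕ.≤-reflexive (≡.trans (deg-^ p≉0 2)
        (≡.cong₂ ℕ._+_ d≡1 (ℕ.*-identityˡ (deg Q))))) (sparse-𝔽₂ (q≡2⇒≈1 ≡2))

  obstructed⇒¬chenPair : ∀ {f g m Q k} → NonConstant f → Q ^ k * m ∣ g → g ∣ Q ^ k * m →
    Comaximal m Q → PrimeFactor (Q , k) → Obstructed q (deg Q) k (deg f) → ¬ ChenPair 𝔽 f g
  obstructed⇒¬chenPair {f} {g} {m} {Q} {k} f-nc Qm∣g g∣Qm m⊥Q (_ , irr , _) = λ where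
      (large 3≤q 2≤k d<n) →
        -- With b different from 0 and -1, the constants 1, b and 1 + b are all units, hence not
        -- multiples of Q.
        let (b , b≉0 , b≉-1) = 3≤q⇒avoid₂ 3≤q F.0# (F.- F.1#) in
        obstruct² nc irr {f} {g} {m} {1#} {const b} k 0 f-nc Qm∣g g∣Qm m⊥Q 2≤k d<n
          (vanishes-const F.1#) (vanishes-const b)
          (NonConstant⇒∤const nc F.1≉0) (NonConstant⇒∤const nc b≉0)
          (NonConstant⇒∤const nc (λ e → b≉-1 (1+b≈0⇒b≈-1 e)))
      (large-𝔽₂ _ 2≤k 2≤d 1+d<n) →
        -- As Q has degree at least 2, it divides none of 1, t and 1 + t.
        obstruct² nc irr {f} {g} {m} {1#} {t} k 1 f-nc Qm∣g g∣Qm m⊥Q 2≤k 1+d<n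
          (vanishes-≤ 1# (s≤s z≤n) (vanishes-const F.1#)) vanishes-t
          (NonConstant⇒∤const nc F.1≉0)
          (λ Q∣t → F.1≉0 (at (∣∧vanishes⇒≈0 {Q} t Q∣t (vanishes-≤ t 2≤d vanishes-t)) 1))
          (λ Q∣1+t → F.1≉0 (at (∣∧vanishes⇒≈0 {Q} (1# + t) Q∣1+t
            (vanishes-≤ (1# + t) 2≤d (vanishes-+ 1# t
              (vanishes-≤ 1# (s≤s z≤n) (vanishes-const F.1#)) vanishes-t))) 1))
      (linear-𝔽₂ _ d≡1 3≤k 2<n) →
        obstruct³ nc irr {f} {g} {m} k f-nc Qm∣g g∣Qm m⊥Q 3≤k
          (≡.subst (λ d → d ℕ.+ d ℕ.< deg f) (≡.sym d≡1) 2<n)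
    where
    nc = irreducible⇒nonConstant irr
    t : Poly
    t = F.0# ∷ F.1# ∷ []
    vanishes-t : VanishesFrom 2 t
    vanishes-t (suc zero)    (s≤s ())
    vanishes-t (suc (suc k)) _ = F.refl
    vanishes-const : ∀ a → VanishesFrom 1 (const a)
    vanishes-const a (suc k) _ = F.refl
    1+b≈0⇒b≈-1 : ∀ {b} → F.1# F.+ b F.≈ F.0# → b F.≈ F.- F.1#
    1+b≈0⇒b≈-1 {b} = GroupProperties.inverseʳ-unique F.+-group F.1# b

  module _ (f g : Poly) (f-nc : NonConstant f) (g-nc : NonConstant g) where

    open Factorisation (factorise g (NonConstant⇒≉0 g-nc))

    w : Poly × ℕ → ℕ ⁺
    w (Q , k) = γ-primePower q (deg Q) k

    ∏∣g : ∏ factors ∣ g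
    ∏∣g = const unit , sym factorises

    g∣∏ : g ∣ ∏ factors
    g∣∏ = let (u , uc≈1) = const∣1 unit≉0 in u , trans (*-congˡ {u} factorises)
      (trans (sym (*-assoc u (const unit) (∏ factors)))
        (trans (*-congʳ {∏ factors} uc≈1) (*-identityˡ (∏ factors))))

    chenPair⇒ : ChenPair 𝔽 f g → [ deg f ] <⁺ γ 𝔽 g g-nc
    chenPair⇒ chen = All⇒<⁺minimum w (All.tabulate below-γ)
      where
      below-γ : ∀ {x} → x ∈ factors → [ deg f ] <⁺ w x
      -- Decidability of the order justifies the contraposition at each prime power.
      below-γ {Q , k} x∈ with <⁺-dec ℕ._<?_ [ deg f ] (w (Q , k))
      ... | yes n<γ = n<γ
      ... | no  n≮γ =
        let pf@(_ , irr , 1≤k) = All.lookup primeFactors x∈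
            (m , ∏≈ , m⊥Q) = cofactor primeFactors distinct x∈
            obstruction = ≮γ⇒Obstructed q (deg Q) k (deg f) 2≤q (irreducible⇒nonConstant irr) 1≤k n≮γ
        in contradiction chen (obstructed⇒¬chenPair {f} {g} {m} {Q} {k} f-nc
             (∣ʳ-respˡ-≈ ∏≈ ∏∣g) (∣ʳ-respʳ-≈ ∏≈ g∣∏) m⊥Q pf obstruction)

    <γ⇒chenPair : [ deg f ] <⁺ γ 𝔽 g g-nc → ChenPair 𝔽 f g
    <γ⇒chenPair n<γ = Chen⇒ChenPair f g (chen-resp ∏∣g g∣∏ (chen-∏ primeFactors distinct
      (All.tabulate λ {x} x∈ →
        let (_ , irr , 1≤k) = All.lookup primeFactors x∈ in
        unobstructed⇒chen irr 1≤k (<γ⇒Unobstructed q _ _ (deg f) 2≤q (irreducible⇒nonConstant irr) 1≤k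
          (All.lookup (<⁺minimum⇒All w factors n<γ) x∈)))))

theorem1p8 : ∀ {c ℓ : Level} (q : ℕ) → PrimePower q → (F : FiniteField c ℓ q) →
    let open 𝔽[t] F in
    (f g : Poly) → NonConstant f → (g-nonConstant : NonConstant g) →
    ChenPair F f g ⇔ ([ deg f ] <⁺ γ F g g-nonConstant)
theorem1p8 q _ F f g f-nc g-nc = mk⇔ (chenPair⇒ f g f-nc g-nc) (<γ⇒chenPair f g f-nc g-nc)
  where open Characterisation F
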